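{- For every prime $p$ the following supercongruences hold (congruences are understood in the ring of rational numbers whose denominators are not divisible by $p$): \begin{align*} \sum_{n=0}^{(p-1)/2}\frac{(\frac12)_n^3}{n!^3}(3n+1)2^{2n} &\equiv p\pmod{p^3} \quad\text{for $p>2$},\\ \sum_{n=0}^{(p-1)/2}\frac{(\frac12)_n^5}{n!^5}(10n^2+6n+1)(-1)^n2^{2n} &\equiv p^2\pmod{p^5} \quad\text{for $p>3$},\\ \sum_{n=0}^{p-1}\frac{(\frac12)_n^3}{(1)_n^3}(3n+1)(-1)^n2^{3n} &\equiv(-1)^{(p-1)/2}p\pmod{p^3} \quad\text{for $p>2$}. \end{align*}
   Context: $p$ denotes a prime. For a real $a$ and a nonnegative integer $n$, $(a)_n=\prod_{k=0}^{n-1}(a+k)$ is the Pochhammer symbol, with $(a)_0=1$; in particular $(1)_n=n!$. -}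

module Defs where

open import Data.Nat as ℕ using (ℕ; zero; suc; _!)
open import Data.Nat.Properties using (_!≢0)
open import Data.Nat.Divisibility using (_∣_)
open import Data.Integer using (+_)
open import Data.Rational using (ℚ; _+_; _*_; _-_; -_; ↧ₙ_; 0ℚ; 1ℚ; ½) renaming (_/_ to _//_)
open import Data.Product using (Σ; _×_)
open import Relation.Nullary using (¬_)
open import Relation.Binary.PropositionalEquality using (_≡_)

ℕ→ℚ : ℕ → ℚ
ℕ→ℚ n = + n // 1

_^ℚ_ : ℚ → ℕ → ℚ
a ^ℚ zero = 1ℚ
a ^ℚ suc n = (a ^ℚ n) * a

poch : ℚ → ℕ → ℚ
poch a zero = 1ℚ
poch a (suc n) = poch a n * (a + ℕ→ℚ n)

inv! : ℕ → ℚ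
inv! n = (+ 1 // (n !)) {{n !≢0}}

sumTo : ℕ → (ℕ → ℚ) → ℚ
sumTo zero f = f 0
sumTo (suc N) f = sumTo N f + f (suc N)

-- a ≡ b (mod p^k) in the ring Z_(p) of rationals with denominator prime to p:
-- a - b = p^k * x for some rational x whose (reduced) denominator is not divisible by p
CongPow : ℕ → ℕ → ℚ → ℚ → Set
CongPow p k a b = Σ ℚ (λ x → (a - b ≡ (ℕ→ℚ p ^ℚ k) * x) × ¬ (p ∣ ↧ₙ x))

term1 : ℕ → ℚ
term1 n = (poch ½ n ^ℚ 3) * (inv! n ^ℚ 3) * (ℕ→ℚ (3 ℕ.* n) + 1ℚ) * (ℕ→ℚ 2 ^ℚ (2 ℕ.* n))

term2 : ℕ → ℚ
term2 n = (poch ½ n ^ℚ 5) * (inv! n ^ℚ 5)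
        * (ℕ→ℚ (10 ℕ.* (n ℕ.* n)) + ℕ→ℚ (6 ℕ.* n) + 1ℚ)
        * ((- 1ℚ) ^ℚ n) * (ℕ→ℚ 2 ^ℚ (2 ℕ.* n))

-- (1)_n = n!, so dividing by (1)_n^3 is multiplying by (1/n!)^3
term3 : ℕ → ℚ
term3 n = (poch ½ n ^ℚ 3) * (inv! n ^ℚ 3) * (ℕ→ℚ (3 ℕ.* n) + 1ℚ)
        * ((- 1ℚ) ^ℚ n) * (ℕ→ℚ 2 ^ℚ (3 ℕ.* n))

{-# OPTIONS --safe #-}
module Submission where

-- For the first two sums put F(n,τ) = (±1)ⁿ (2n choose n) ((τ)ₙ/n!)ᵉ L(n,τ) with e = 2, L = 3n+2τ,
-- respectively e = 4, L = 10n²+12nτ+4τ²; the given summands are F(n,½).  A WZ certificate makes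
-- F(n,τ+1) - F(n,τ) telescope in n.  Summing over n < p and moving τ from ½ to p/2, all boundary terms
-- vanish modulo pᵉ⁺¹, and at τ = p/2 only L(0,p/2) + (p/2)ᵉ W survives, where W is the sum of
-- (±1)ⁿ (2n choose n) L(n,0)/nᵉ over 0 < n < p.  Moving τ from -p to 0 instead gives the exact identity
-- Σ_{n≤p} F(n,-p) = 0, which says pᵉ W ≡ 0 because (2p choose p) ≡ 2 modulo p² (modulo p³ if p > 3).
--
-- The third summand is the case a = b = 0 of
--   (3n+1+(a+b)p) (½+ap/2)ₙ (½+bp/2)ₙ (½+(a+b)p/2)ₙ (-8)ⁿ / (n! (1+ap)ₙ (1+bp)ₙ).
-- Its terminating sum over n is (-1)^((p-1)/2) p at (a,b) = (-1,1), and 0 at (-1,0) and (-2,1).  Modulo p³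
-- the ratio to the case a = b = 0 is 1 + (a+b)φp + ((a+b)²χ + abψ)p² with φ, χ, ψ independent of a and b,
-- so half the difference of the last two sums cancels the error of the first.

open import Defs
open import Algebra.Bundles using (CommutativeRing)
import Algebra.Solver.Ring as RingSolver
open import Algebra.Solver.Ring.AlmostCommutativeRing using (fromCommutativeRing; _-Raw-AlmostCommutative⟶_)
open import Algebra.Structures using (IsCommutativeRing)
open import Data.Empty using (⊥-elim)
open import Data.Integer as ℤ using (ℤ; -[1+_]) renaming (+_ to pos)
import Data.Integer.Properties as ℤₚ
open import Data.Maybe using (Maybe; just; nothing)
open import Data.Nat using (ℕ; _<_; _∸_; ⌊_/2⌋; _!)
open import Data.Nat as ℕ using (zero; suc)
open import Data.Nat.Coprimality as Coprimality using (1-coprimeTo)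
open import Data.Nat.Divisibility using (_∣_; divides; _∣0; >⇒∤; ∣m+n∣m⇒∣n; ∣-refl; ∣-trans; ∣1⇒≡1)
open import Data.Nat.Primality using (Prime; euclidsLemma; prime⇒irreducible; ¬prime[1])
import Data.Nat.Properties as ℕₚ
open import Data.Nat.Properties using (_!≢0)
open import Data.Product using (Σ; ∃; _×_; _,_)
open import Data.Rational as ℚ using (ℚ; mkℚ; 0ℚ; 1ℚ; ½) renaming (_/_ to _//_)
import Data.Rational.Properties as ℚₚ
open import Data.Sum using (_⊎_; inj₁; inj₂)
open import Relation.Binary.PropositionalEquality using (_≡_; refl; sym; trans; cong; cong₂; subst; subst₂; module ≡-Reasoning)
open import Relation.Nullary using (¬_; yes; no)
open ≡-Reasoning

-- The exponent e+1 is a count of factors p: one from the central binomial coefficient once n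
-- exceeds (p-1)/2, and one from each of the e copies of (τ)ₙ/n! that contain the factor p/2. For
-- this reason one copy of (½)ₙ/n! is frozen as a binomial coefficient independent of τ. The
-- obstacle for the first two sums is W, a harmonic-type sum with no evident value modulo p. The
-- approximation L(0,τ) + τᵉ W holds with the same W at every τ divisible by p, so a second such τ
-- at which the full sum is known exactly eliminates W; e is even, so passing from p to -p costs no
-- sign. For the third sum the obstacle is that no closed evaluation is available at a = b = 0, and
-- φ, ψ, χ are unknown. The points (-1,0) and (-2,1) share a+b = -1, so φ and χ drop out of their
-- difference, and ab = 0 against ab = -2 leaves ψ alone. At (-1,1) one has a+b = 0, so ψ is the
-- whole error there too.

-- Commutative rings: integer-coefficient solver, powers, finite sums

module Ring
  {A : Set} {_⊕_ _⊗_ : A → A → A} {⊝_ : A → A} {𝟘 𝟙 : A}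
  (isCommutativeRing : IsCommutativeRing _≡_ _⊕_ _⊗_ ⊝_ 𝟘 𝟙)
  where

  commutativeRing : CommutativeRing _ _
  commutativeRing = record { isCommutativeRing = isCommutativeRing }

  open CommutativeRing commutativeRing public
    hiding (isCommutativeRing; refl; sym; trans; reflexive; zero; setoid)
  open import Algebra.Properties.Ring ring public
  open import Algebra.Properties.AbelianGroup +-abelianGroup using (⁻¹-∙-comm)
  open import Algebra.Properties.Semiring.Mult.TCOptimised semiring using (1+×; ×-homo-+; ×1-homo-*) renaming (_×_ to _·_)

  ι : ℕ → A
  ι n = n · 1#

  ι-suc : ∀ n → ι (suc n) ≡ 1# + ι n
  ι-suc n = 1+× n 1#

  ι-+ : ∀ m n → ι (m ℕ.+ n) ≡ ι m + ι n
  ι-+ = ×-homo-+ 1#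

  ι-* : ∀ m n → ι (m ℕ.* n) ≡ ι m * ι n
  ι-* = ×1-homo-*

  private
    ⟦_⟧ : ℤ → A
    ⟦ pos n ⟧ = ι n
    ⟦ -[1+ n ] ⟧ = - ι (suc n)

    cancel-one : ∀ x y → (1# + x) - (1# + y) ≡ x - y
    cancel-one x y = begin
      (1# + x) - (1# + y)        ≡⟨ cong ((1# + x) +_) (⁻¹-∙-comm 1# y) ⟨
      (1# + x) + ((- 1#) - y)    ≡⟨ cong (_+ ((- 1#) - y)) (+-comm 1# x) ⟩
      (x + 1#) + ((- 1#) - y)    ≡⟨ +-assoc x 1# _ ⟩
      x + (1# + ((- 1#) - y))    ≡⟨ cong (x +_) (+-assoc 1# (- 1#) (- y)) ⟨
      x + ((1# - 1#) - y)        ≡⟨ cong (λ u → x + (u - y)) (-‿inverseʳ 1#) ⟩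
      x + (0# - y)               ≡⟨ cong (x +_) (+-identityˡ _) ⟩
      x - y ∎

    ⊖-homo : ∀ m n → ⟦ m ℤ.⊖ n ⟧ ≡ ι m - ι n
    ⊖-homo m zero = sym (trans (cong (ι m +_) -0#≈0#) (+-identityʳ _))
    ⊖-homo zero (suc n) = sym (+-identityˡ _)
    ⊖-homo (suc m) (suc n) = begin
      ⟦ suc m ℤ.⊖ suc n ⟧   ≡⟨ cong ⟦_⟧ (ℤₚ.[1+m]⊖[1+n]≡m⊖n m n) ⟩
      ⟦ m ℤ.⊖ n ⟧           ≡⟨ ⊖-homo m n ⟩
      ι m - ι n             ≡⟨ cancel-one (ι m) (ι n) ⟨
      (1# + ι m) - (1# + ι n) ≡⟨ cong₂ _-_ (ι-suc m) (ι-suc n) ⟨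
      ι (suc m) - ι (suc n) ∎

    neg-homo : ∀ i → ⟦ ℤ.- i ⟧ ≡ - ⟦ i ⟧
    neg-homo (pos zero) = sym -0#≈0#
    neg-homo (pos (suc n)) = refl
    neg-homo -[1+ n ] = sym (-‿involutive _)

    add-homo : ∀ i j → ⟦ i ℤ.+ j ⟧ ≡ ⟦ i ⟧ + ⟦ j ⟧
    add-homo (pos m) (pos n) = ι-+ m n
    add-homo (pos m) -[1+ n ] = ⊖-homo m (suc n)
    add-homo -[1+ m ] (pos n) = trans (⊖-homo n (suc m)) (+-comm _ _)
    add-homo -[1+ m ] -[1+ n ] = begin
      - ι (suc (suc (m ℕ.+ n)))    ≡⟨ cong (λ k → - ι k) (ℕₚ.+-suc (suc m) n) ⟨
      - ι (suc m ℕ.+ suc n)        ≡⟨ cong -_ (ι-+ (suc m) (suc n)) ⟩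
      - (ι (suc m) + ι (suc n))    ≡⟨ ⁻¹-∙-comm _ _ ⟨
      - ι (suc m) - ι (suc n) ∎

    mul-homo-pos : ∀ m j → ⟦ pos m ℤ.* j ⟧ ≡ ι m * ⟦ j ⟧
    mul-homo-pos m (pos n) = trans (cong ⟦_⟧ (sym (ℤₚ.pos-* m n))) (ι-* m n)
    mul-homo-pos m -[1+ n ] = begin
      ⟦ pos m ℤ.* ℤ.- pos (suc n) ⟧    ≡⟨ cong ⟦_⟧ (ℤₚ.neg-distribʳ-* (pos m) (pos (suc n))) ⟨
      ⟦ ℤ.- (pos m ℤ.* pos (suc n)) ⟧  ≡⟨ neg-homo (pos m ℤ.* pos (suc n)) ⟩
      - ⟦ pos m ℤ.* pos (suc n) ⟧      ≡⟨ cong -_ (mul-homo-pos m (pos (suc n))) ⟩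
      - (ι m * ι (suc n))              ≡⟨ -‿distribʳ-* _ _ ⟩
      ι m * - ι (suc n) ∎

    mul-homo : ∀ i j → ⟦ i ℤ.* j ⟧ ≡ ⟦ i ⟧ * ⟦ j ⟧
    mul-homo (pos m) j = mul-homo-pos m j
    mul-homo -[1+ m ] j = begin
      ⟦ (ℤ.- pos (suc m)) ℤ.* j ⟧  ≡⟨ cong ⟦_⟧ (ℤₚ.neg-distribˡ-* (pos (suc m)) j) ⟨
      ⟦ ℤ.- (pos (suc m) ℤ.* j) ⟧  ≡⟨ neg-homo (pos (suc m) ℤ.* j) ⟩
      - ⟦ pos (suc m) ℤ.* j ⟧      ≡⟨ cong -_ (mul-homo-pos (suc m) j) ⟩
      - (ι (suc m) * ⟦ j ⟧)        ≡⟨ -‿distribˡ-* _ _ ⟩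
      (- ι (suc m)) * ⟦ j ⟧ ∎

    -- Equality in `A` is abstract, so the solver takes its coefficients in ℤ, where numerals can be
    -- compared.
    ℤ⟶A : ℤ.+-*-rawRing -Raw-AlmostCommutative⟶ fromCommutativeRing commutativeRing
    ℤ⟶A = record
      { ⟦_⟧ = ⟦_⟧ ; +-homo = add-homo ; *-homo = mul-homo ; -‿homo = neg-homo
      ; 0-homo = refl ; 1-homo = refl }

    _coeff≟_ : ∀ i j → Maybe (⟦ i ⟧ ≡ ⟦ j ⟧)
    i coeff≟ j with i ℤ.≟ j
    ... | yes i≡j = just (cong ⟦_⟧ i≡j)
    ... | no _    = nothing

  open RingSolver ℤ.+-*-rawRing (fromCommutativeRing commutativeRing) ℤ⟶A _coeff≟_ public
    using (solve; _:=_; _:+_; _:*_; _:-_; :-_; con; Polynomial)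

  # : ∀ {n} → ℕ → Polynomial n
  # k = con (pos k)


  infixr 8 _^_

  _^_ : A → ℕ → A
  x ^ zero = 1#
  x ^ suc n = x ^ n * x

  ^-+ : ∀ x m n → x ^ (m ℕ.+ n) ≡ x ^ m * x ^ n
  ^-+ x zero n = sym (*-identityˡ _)
  ^-+ x (suc m) n = trans (cong (_* x) (^-+ x m n))
    (solve 3 (λ a b x → a :* b :* x := a :* x :* b) refl (x ^ m) (x ^ n) x)

  ^-distrib-* : ∀ x y n → (x * y) ^ n ≡ x ^ n * y ^ n
  ^-distrib-* x y zero = sym (*-identityˡ _)
  ^-distrib-* x y (suc n) = trans (cong (_* (x * y)) (^-distrib-* x y n))
    (solve 4 (λ a b x y → a :* b :* (x :* y) := a :* x :* (b :* y)) refl (x ^ n) (y ^ n) x y)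

  1^n≡1 : ∀ n → 1# ^ n ≡ 1#
  1^n≡1 zero = refl
  1^n≡1 (suc n) = trans (*-identityʳ _) (1^n≡1 n)

  ^-* : ∀ x m n → x ^ (m ℕ.* n) ≡ (x ^ m) ^ n
  ^-* x zero n = sym (1^n≡1 n)
  ^-* x (suc m) n = begin
    x ^ (n ℕ.+ m ℕ.* n)      ≡⟨ ^-+ x n (m ℕ.* n) ⟩
    x ^ n * x ^ (m ℕ.* n)    ≡⟨ cong (x ^ n *_) (^-* x m n) ⟩
    x ^ n * (x ^ m) ^ n      ≡⟨ *-comm _ _ ⟩
    (x ^ m) ^ n * x ^ n      ≡⟨ ^-distrib-* (x ^ m) x n ⟨
    (x ^ suc m) ^ n ∎

  inverse-unique : ∀ {x y z} → x * y ≡ 1# → x * z ≡ 1# → y ≡ z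
  inverse-unique {x} {y} {z} xy≡1 xz≡1 = begin
    y            ≡⟨ *-identityʳ y ⟨
    y * 1#       ≡⟨ cong (y *_) xz≡1 ⟨
    y * (x * z)  ≡⟨ solve 3 (λ x y z → y :* (x :* z) := x :* y :* z) refl x y z ⟩
    x * y * z    ≡⟨ cong (_* z) xy≡1 ⟩
    1# * z       ≡⟨ *-identityˡ z ⟩
    z ∎

  sum : ℕ → (ℕ → A) → A
  sum zero f = f 0
  sum (suc n) f = sum n f + f (suc n)

-- Pochhammer quotients and central binomial coefficients

module Hypergeometric
  {A : Set} {_⊕_ _⊗_ : A → A → A} {⊝_ : A → A} {𝟘 𝟙 : A}
  (isCommutativeRing : IsCommutativeRing _≡_ _⊕_ _⊗_ ⊝_ 𝟘 𝟙)
  (rec : ℕ → A)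
  (rec-inverse : ∀ n → Ring.ι isCommutativeRing (suc n) ⊗ rec (suc n) ≡ 𝟙)
  where

  open Ring isCommutativeRing

  -- q τ n = (τ)ₙ / n!
  q : A → ℕ → A
  q τ zero = 1#
  q τ (suc n) = q τ n * (τ + ι n) * rec (suc n)

  -- The first factor of (τ)ₙ₊₁ is split off instead of the last. This is what relates the
  -- parameters τ and τ+1.
  q-suc : ∀ τ n → q τ (suc n) ≡ τ * rec (suc n) * q (τ + 1#) n
  q-suc τ zero = solve 2 (λ τ z → # 1 :* (τ :+ # 0) :* z := τ :* z :* # 1) refl τ (rec 1)
  q-suc τ (suc n) = begin
    q τ (suc n) * (τ + ι (suc n)) * rec (2 ℕ.+ n)
      ≡⟨ cong₂ (λ u v → u * (τ + v) * rec (2 ℕ.+ n)) (q-suc τ n) (ι-suc n) ⟩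
    τ * rec (suc n) * q (τ + 1#) n * (τ + (1# + ι n)) * rec (2 ℕ.+ n)
      ≡⟨ solve 5 (λ τ z r N y → τ :* z :* r :* (τ :+ (# 1 :+ N)) :* y := τ :* y :* (r :* (τ :+ # 1 :+ N) :* z)) refl
           τ (rec (suc n)) (q (τ + 1#) n) (ι n) (rec (2 ℕ.+ n)) ⟩
    τ * rec (2 ℕ.+ n) * q (τ + 1#) (suc n) ∎

  q-vanish : ∀ τ {j n} → j ℕ.< n → τ + ι j ≡ 0# → q τ n ≡ 0#
  q-vanish τ {j} {suc n} (ℕ.s≤s j≤n) eq with ℕₚ.m≤n⇒m<n∨m≡n j≤n
  ... | inj₁ j<n = trans (cong (λ u → u * (τ + ι n) * rec (suc n)) (q-vanish τ j<n eq))
                         (solve 2 (λ x z → # 0 :* x :* z := # 0) refl _ _)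
  ... | inj₂ refl = trans (cong (λ u → q τ n * u * rec (suc n)) eq)
                         (solve 2 (λ x z → x :* # 0 :* z := # 0) refl _ _)

  q[-n]n : ∀ n → q (- ι n) n ≡ (- 1#) ^ n
  q[-n]n zero = refl
  q[-n]n (suc n) = begin
    q (- ι (suc n)) (suc n)                                   ≡⟨ q-suc (- ι (suc n)) n ⟩
    - ι (suc n) * rec (suc n) * q (- ι (suc n) + 1#) n
      ≡⟨ cong₂ (λ u v → u * q v n)
           (trans (sym (-‿distribˡ-* _ _)) (cong -_ (rec-inverse n)))
           (trans (cong (λ u → - u + 1#) (ι-suc n)) (solve 1 (λ N → :- (# 1 :+ N) :+ # 1 := :- N) refl (ι n))) ⟩
    - 1# * q (- ι n) n                                        ≡⟨ cong (- 1# *_) (q[-n]n n) ⟩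
    - 1# * (- 1#) ^ n                                         ≡⟨ *-comm _ _ ⟩
    (- 1#) ^ n * - 1# ∎

  -- weight ε n = εⁿ (2n choose n)
  weight : A → ℕ → A
  weight ε zero = 1#
  weight ε (suc n) = weight ε n * ε * rec (suc n) * (ι 4 * ι n + ι 2)

  weight-sign : ∀ ε n → weight ε n ≡ ε ^ n * weight 1# n
  weight-sign ε zero = sym (*-identityˡ _)
  weight-sign ε (suc n) = trans (cong (λ u → u * ε * rec (suc n) * (ι 4 * ι n + ι 2)) (weight-sign ε n))
    (solve 5 (λ a w e z x → a :* w :* e :* z :* x := a :* e :* (w :* # 1 :* z :* x)) refl (ε ^ n) (weight 1# n) ε (rec (suc n)) _)

  -- Trades one factor (½)ₙ/n! of the summands together with 2²ⁿ for a central binomial coefficient;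
  -- `rec 2` plays the part of ½, and 4n+2 = 4(½+n).
  weight≡4ⁿq : ∀ n → weight 1# n ≡ ι 4 ^ n * q (rec 2) n
  weight≡4ⁿq zero = sym (*-identityˡ _)
  weight≡4ⁿq (suc n) = begin
    weight 1# n * 1# * z * (ι 4 * ι n + ι 2)
      ≡⟨ cong (λ u → u * 1# * z * (ι 4 * ι n + ι 2)) (weight≡4ⁿq n) ⟩
    ι 4 ^ n * q (rec 2) n * 1# * z * (ι 4 * ι n + ι 2)
      ≡⟨ solve 4 (λ f x z N →
              f :* x :* # 1 :* z :* (# 4 :* N :+ # 2)
              := f :* x :* z :* (# 4 :* N :+ # 2 :* # 1)) refl (ι 4 ^ n) (q (rec 2) n) z (ι n) ⟩
    ι 4 ^ n * q (rec 2) n * z * (ι 4 * ι n + ι 2 * 1#)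
      ≡⟨ cong (λ u → ι 4 ^ n * q (rec 2) n * z * (ι 4 * ι n + ι 2 * u)) (rec-inverse 1) ⟨
    ι 4 ^ n * q (rec 2) n * z * (ι 4 * ι n + ι 2 * (ι 2 * rec 2))
      ≡⟨ solve 5 (λ f x z N h →
              f :* x :* z :* (# 4 :* N :+ # 2 :* (# 2 :* h))
              := f :* # 4 :* (x :* (h :+ N) :* z)) refl (ι 4 ^ n) (q (rec 2) n) z (ι n) (rec 2) ⟩
    ι 4 ^ suc n * q (rec 2) (suc n) ∎
    where z = rec (suc n)

  weight≡q : ∀ n → weight 1# n ≡ q (ι n + 1#) n
  -- This is (2n+2 choose n+1) = 2 (2n+1 choose n). The two identities are proved together, each by
  -- one step from the other; with n+1 = p the present one leads to (2p choose p) modulo powers of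
  -- p.
  weight-suc≡2q : ∀ n → weight 1# (suc n) ≡ ι 2 * q (ι (suc n) + 1#) n

  weight≡q zero = refl
  weight≡q (suc n) = begin
    weight 1# (suc n)                 ≡⟨ weight-suc≡2q n ⟩
    ι 2 * q (ι (suc n) + 1#) n        ≡⟨ solve 1 (λ x → # 2 :* x := x :* (# 2 :* # 1)) refl _ ⟩
    q (ι (suc n) + 1#) n * (ι 2 * 1#)
      ≡⟨ cong (λ u → q (ι (suc n) + 1#) n * (ι 2 * u)) (rec-inverse n) ⟨
    q (ι (suc n) + 1#) n * (ι 2 * (ι (suc n) * rec (suc n)))
      ≡⟨ cong (λ u → q (ι (suc n) + 1#) n * (ι 2 * (u * rec (suc n)))) (ι-suc n) ⟩
    q (ι (suc n) + 1#) n * (ι 2 * ((1# + ι n) * rec (suc n)))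
      ≡⟨ solve 3 (λ x N z → x :* (# 2 :* ((# 1 :+ N) :* z)) := x :* ((# 1 :+ N) :+ # 1 :+ N) :* z) refl _ _ _ ⟩
    q (ι (suc n) + 1#) n * ((1# + ι n) + 1# + ι n) * rec (suc n)
      ≡⟨ cong (λ u → q (ι (suc n) + 1#) n * (u + 1# + ι n) * rec (suc n)) (ι-suc n) ⟨
    q (ι (suc n) + 1#) (suc n) ∎

  weight-suc≡2q n = begin
    weight 1# n * 1# * z * (ι 4 * ι n + ι 2)        ≡⟨ cong (λ u → u * 1# * z * (ι 4 * ι n + ι 2)) (weight≡q n) ⟩
    q (ι n + 1#) n * 1# * z * (ι 4 * ι n + ι 2)
      ≡⟨ solve 3 (λ x z N → x :* # 1 :* z :* (# 4 :* N :+ # 2) := # 2 :* (x :* (N :+ # 1 :+ N) :* z)) refl _ _ _ ⟩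
    ι 2 * q (ι n + 1#) (suc n)                      ≡⟨ cong (ι 2 *_) (q-suc (ι n + 1#) n) ⟩
    ι 2 * ((ι n + 1#) * z * q (ι n + 1# + 1#) n)
      ≡⟨ cong (λ u → ι 2 * (u * z * q (u + 1#) n)) (trans (+-comm _ _) (sym (ι-suc n))) ⟩
    ι 2 * (ι (suc n) * z * q (ι (suc n) + 1#) n)    ≡⟨ cong (λ u → ι 2 * (u * q (ι (suc n) + 1#) n)) (rec-inverse n) ⟩
    ι 2 * (1# * q (ι (suc n) + 1#) n)               ≡⟨ cong (ι 2 *_) (*-identityˡ _) ⟩
    ι 2 * q (ι (suc n) + 1#) n ∎
    where z = rec (suc n)

  -- WZ pairs: telescoping in n for the shift of τ by one

  module WZ
    (ε : A) (ε² : ε * ε ≡ 1#) (e : ℕ) (L g : A → A → A)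
    (certificate₀ : ∀ τ → L 0# (τ + 1#) ≡ L 0# τ + ι 2 * g 0# τ)
    (certificate : ∀ N τ →
      (τ + (1# + N)) ^ e * L (1# + N) (τ + 1#) + ε * ((1# + N) ^ e * (1# + N)) * g N τ
      ≡ τ ^ e * L (1# + N) τ + (ι 4 * (1# + N) + ι 2) * g (1# + N) τ * (τ + (1# + N)) ^ e)
    where

    F : A → ℕ → A
    F τ n = weight ε n * q τ n ^ e * L (ι n) τ

    S : A → ℕ → A
    S τ N = sum N (F τ)

    -- The WZ companion of `F`. It contains (τ+1)_N to the power e, so a root or a multiple of p
    -- among the factors of (τ+1)_N controls the whole boundary term.
    G : A → ℕ → A
    G τ N = weight ε N * (ι 4 * ι N + ι 2) * g (ι N) τ * q (τ + 1#) N ^ e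

    -- By `q-suc` all four terms share the factor `weight ε (suc N)` times the e-th powers of
    -- `q (τ + 1#) N` and `rec (suc N)`. What remains is the polynomial identity `certificate`; the
    -- insertion of ε² = 1 and of z J = 1 brings `G τ N`, which has the weight of index N, to this
    -- common form.
    F-G-step : ∀ τ N → F (τ + 1#) (suc N) + G τ N ≡ F τ (suc N) + G τ (suc N)
    F-G-step τ N = begin
      W * (r * (τ + 1# + ι N) * z) ^ e * L (ι (suc N)) (τ + 1#) + w * x * g₀ * r ^ e
        ≡⟨ cong₂ _+_
             (cong₂ (λ a b → W * a * L b (τ + 1#))
                (trans (cong (λ a → (r * a * z) ^ e) (+-assoc τ 1# (ι N))) (^-distrib₃ r u z))
                (ι-suc N))
             (trans (solve 4 (λ w x g R → w :* x :* g :* R := w :* x :* (# 1 :* # 1) :* g :* (R :* # 1)) refl w x g₀ (r ^ e))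
               (cong₂ (λ a b → w * x * a * g₀ * (r ^ e * b)) (cong₂ _*_ (sym ε²) zJ) (sym ZJ))) ⟩
      W * (r ^ e * u ^ e * z ^ e) * L J (τ + 1#) + w * x * (ε * ε * (z * J)) * g₀ * (r ^ e * (z ^ e * J ^ e))
        ≡⟨ solve 11 (λ w ε z x R U Z L₁ J g₀ Je →
              w :* ε :* z :* x :* (R :* U :* Z) :* L₁ :+ w :* x :* (ε :* ε :* (z :* J)) :* g₀ :* (R :* (Z :* Je))
              := w :* ε :* z :* x :* R :* Z :* (U :* L₁ :+ ε :* (Je :* J) :* g₀)) refl
             w ε z x (r ^ e) (u ^ e) (z ^ e) (L J (τ + 1#)) J g₀ (J ^ e) ⟩
      W * r ^ e * z ^ e * (u ^ e * L J (τ + 1#) + ε * (J ^ e * J) * g₀)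
        ≡⟨ cong (W * r ^ e * z ^ e *_) (certificate (ι N) τ) ⟩
      W * r ^ e * z ^ e * (τ ^ e * L J τ + (ι 4 * J + ι 2) * g J τ * u ^ e)
        ≡⟨ solve 8 (λ W R Z T L₀ y g₁ U →
              W :* R :* Z :* (T :* L₀ :+ y :* g₁ :* U)
              := W :* (T :* Z :* R) :* L₀ :+ W :* y :* g₁ :* (R :* U :* Z)) refl
             W (r ^ e) (z ^ e) (τ ^ e) (L J τ) (ι 4 * J + ι 2) (g J τ) (u ^ e) ⟩
      W * (τ ^ e * z ^ e * r ^ e) * L J τ + W * (ι 4 * J + ι 2) * g J τ * (r ^ e * u ^ e * z ^ e)
        ≡⟨ cong₂ _+_
             (cong₂ (λ a b → W * a * L b τ)
                (sym (trans (cong (_^ e) (q-suc τ N)) (^-distrib₃ τ z r)))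
                (sym (ι-suc N)))
             (cong₂ (λ a b → W * (ι 4 * a + ι 2) * g a τ * b)
                (sym (ι-suc N))
                (sym (trans (cong (λ a → (r * a * z) ^ e) (+-assoc τ 1# (ι N))) (^-distrib₃ r u z)))) ⟩
      F τ (suc N) + G τ (suc N) ∎
      where
      w = weight ε N
      W = weight ε (suc N)
      r = q (τ + 1#) N
      z = rec (suc N)
      x = ι 4 * ι N + ι 2
      J = 1# + ι N
      u = τ + J
      g₀ = g (ι N) τ
      zJ : 1# ≡ z * J
      zJ = trans (sym (rec-inverse N)) (trans (*-comm _ _) (cong (z *_) (ι-suc N)))
      ZJ : z ^ e * J ^ e ≡ 1#
      ZJ = trans (sym (^-distrib-* z J e)) (trans (cong (_^ e) (sym zJ)) (1^n≡1 e))
      ^-distrib₃ : ∀ a b c → (a * b * c) ^ e ≡ a ^ e * b ^ e * c ^ e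
      ^-distrib₃ a b c = trans (^-distrib-* (a * b) c e) (cong (_* c ^ e) (^-distrib-* a b e))

    -- Only the upper boundary value survives: `certificate₀` says that the difference of the terms
    -- n = 0 is already `G τ 0`.
    S-shift : ∀ τ N → S (τ + 1#) N ≡ S τ N + G τ N
    S-shift τ zero = begin
      1# * 1# ^ e * L 0# (τ + 1#)                ≡⟨ cong (1# * 1# ^ e *_) (certificate₀ τ) ⟩
      1# * 1# ^ e * (L 0# τ + ι 2 * g 0# τ)
        ≡⟨ solve 3 (λ o a b →
              # 1 :* o :* (a :+ # 2 :* b)
              := # 1 :* o :* a :+ # 1 :* (# 4 :* # 0 :+ # 2) :* b :* o) refl (1# ^ e) (L 0# τ) (g 0# τ) ⟩
      S τ 0 + G τ 0 ∎
    S-shift τ (suc N) = begin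
      S (τ + 1#) N + F (τ + 1#) (suc N)   ≡⟨ cong (_+ F (τ + 1#) (suc N)) (S-shift τ N) ⟩
      S τ N + G τ N + F (τ + 1#) (suc N)  ≡⟨ solve 3 (λ a b c → a :+ b :+ c := a :+ (c :+ b)) refl _ _ _ ⟩
      S τ N + (F (τ + 1#) (suc N) + G τ N) ≡⟨ cong (S τ N +_) (F-G-step τ N) ⟩
      S τ N + (F τ (suc N) + G τ (suc N)) ≡⟨ +-assoc _ _ _ ⟨
      S τ (suc N) + G τ (suc N) ∎


    module _ (0^e : 0# ^ e ≡ 0#) (L₀₀ : L 0# 0# ≡ 0#) where

      S-at-0 : ∀ N → S 0# N ≡ 0#
      S-at-0 zero = trans (cong (1# * 1# ^ e *_) L₀₀) (zeroʳ _)
      S-at-0 (suc N) = begin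
        S 0# N + weight ε (suc N) * q 0# (suc N) ^ e * L (ι (suc N)) 0#
          ≡⟨ cong₂ (λ a b → a + weight ε (suc N) * b * L (ι (suc N)) 0#) (S-at-0 N)
               (trans (cong (_^ e) (q-vanish 0# (ℕ.s≤s ℕ.z≤n) (+-identityʳ 0#))) 0^e) ⟩
        0# + weight ε (suc N) * 0# * L (ι (suc N)) 0#
          ≡⟨ solve 2 (λ a b → # 0 :+ a :* # 0 :* b := # 0) refl _ _ ⟩
        0# ∎

      -- Since (-k)_N = 0 for k < N, no boundary term appears on the way from τ = 0 down to τ = -N,
      -- and at τ = 0 every term vanishes.
      S-at-neg : ∀ N k → k ℕ.≤ N → S (- ι k) N ≡ 0#
      S-at-neg N zero _ = trans (cong (λ τ → S τ N) -0#≈0#) (S-at-0 N)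
      S-at-neg N (suc k) k<N = begin
        S τ N                      ≡⟨ +-identityʳ _ ⟨
        S τ N + 0#                 ≡⟨ cong (S τ N +_) G≡0 ⟨
        S τ N + G τ N              ≡⟨ S-shift τ N ⟨
        S (τ + 1#) N               ≡⟨ cong (λ u → S u N) τ+1 ⟩
        S (- ι k) N                ≡⟨ S-at-neg N k (ℕₚ.<⇒≤ k<N) ⟩
        0# ∎
        where
        τ = - ι (suc k)
        τ+1 : τ + 1# ≡ - ι k
        τ+1 = trans (cong (λ u → - u + 1#) (ι-suc k)) (solve 1 (λ N → :- (# 1 :+ N) :+ # 1 := :- N) refl (ι k))
        G≡0 : G τ N ≡ 0#
        G≡0 = trans (cong (weight ε N * (ι 4 * ι N + ι 2) * g (ι N) τ *_)
                      (trans (cong (_^ e) (trans (cong (λ u → q u N) τ+1)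
                                                 (q-vanish (- ι k) k<N (-‿inverseˡ (ι k))))) 0^e))
                    (zeroʳ _)

  -- Terminating sums for the third congruence

  -- The summand (3n+1+α+β) (½+α/2)ₙ (½+β/2)ₙ (½+(α+β)/2)ₙ (-8)ⁿ / (n! (1+α)ₙ (1+β)ₙ), with the
  -- denominators cleared: Ŝ N is the sum up to N multiplied by the denominator of its last term.
  numer : A → A → ℕ → A
  numer α β zero = 1#
  numer α β (suc n) =
    - (numer α β n * ((1# + α + ι 2 * ι n) * (1# + β + ι 2 * ι n) * (1# + α + β + ι 2 * ι n)))

  -- The quotient of consecutive denominators n! (1+α)ₙ (1+β)ₙ.
  δ : A → A → ℕ → A
  δ α β n = (1# + ι n) * (1# + α + ι n) * (1# + β + ι n)

  ℓ : A → A → ℕ → A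
  ℓ α β n = ι 3 * ι n + 1# + α + β

  Ŝ : A → A → ℕ → A
  Ŝ α β zero = ℓ α β 0
  Ŝ α β (suc n) = Ŝ α β n * δ α β n + numer α β (suc n) * ℓ α β (suc n)

  -- Raising α by 2 moves the index of the factors 1+α+2k and 1+α+β+2k by one, so only the end
  -- factors of these products change.
  numer-shift : ∀ α β n → (1# + α) * (1# + α + β) * numer (α + ι 2) β n
                        ≡ (1# + α + ι 2 * ι n) * (1# + α + β + ι 2 * ι n) * numer α β n
  numer-shift α β zero =
    solve 2 (λ α β →
              (# 1 :+ α) :* (# 1 :+ α :+ β) :* # 1
              := (# 1 :+ α :+ # 2 :* # 0) :* (# 1 :+ α :+ β :+ # 2 :* # 0) :* # 1) refl α β
  numer-shift α β (suc n) = begin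
    (1# + α) * (1# + α + β) * numer (α + ι 2) β (suc n)
      ≡⟨ solve 4 (λ a b M N → a :* b :* :- (M :* N) := :- (a :* b :* M :* N)) refl (1# + α) (1# + α + β) (numer (α + ι 2) β n) c' ⟩
    - ((1# + α) * (1# + α + β) * numer (α + ι 2) β n * c')
      ≡⟨ cong (λ u → - (u * c')) (numer-shift α β n) ⟩
    - ((1# + α + ι 2 * ι n) * (1# + α + β + ι 2 * ι n) * numer α β n * c')
      ≡⟨ solve 4 (λ α β N M →
              :- ((# 1 :+ α :+ # 2 :* N) :* (# 1 :+ α :+ β :+ # 2 :* N) :* M
                :* ((# 1 :+ (α :+ # 2) :+ # 2 :* N) :* (# 1 :+ β :+ # 2 :* N) :* (# 1 :+ (α :+ # 2) :+ β :+ # 2 :* N)))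
              := (# 1 :+ α :+ # 2 :* (# 1 :+ N)) :* (# 1 :+ α :+ β :+ # 2 :* (# 1 :+ N))
                :* :- (M :* ((# 1 :+ α :+ # 2 :* N) :* (# 1 :+ β :+ # 2 :* N) :* (# 1 :+ α :+ β :+ # 2 :* N)))) refl α β (ι n) (numer α β n) ⟩
    (1# + α + ι 2 * (1# + ι n)) * (1# + α + β + ι 2 * (1# + ι n)) * numer α β (suc n)
      ≡⟨ cong (λ u → (1# + α + ι 2 * u) * (1# + α + β + ι 2 * u) * numer α β (suc n)) (ι-suc n) ⟨
    (1# + α + ι 2 * ι (suc n)) * (1# + α + β + ι 2 * ι (suc n)) * numer α β (suc n) ∎
    where c' = (1# + (α + ι 2) + ι 2 * ι n) * (1# + β + ι 2 * ι n) * (1# + (α + ι 2) + β + ι 2 * ι n)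

  -- A WZ relation for α ↦ α+2 with β fixed. Its boundary term is the next numerator, which is also
  -- the last term of the sum up to n+1; combining the two turns the relation into a recursion for
  -- terminating sums.
  Ŝ-shift : ∀ α β n → (1# + α + β) * (1# + α) * Ŝ (α + ι 2) β n + numer α β (suc n)
                    ≡ (1# + α + ι n) * (ι 2 + α + ι n) * Ŝ α β n
  Ŝ-shift α β zero =
    solve 2 (λ α β →
              (# 1 :+ α :+ β) :* (# 1 :+ α) :* (# 3 :* # 0 :+ # 1 :+ (α :+ # 2) :+ β)
                :+ :- (# 1 :* ((# 1 :+ α :+ # 2 :* # 0) :* (# 1 :+ β :+ # 2 :* # 0) :* (# 1 :+ α :+ β :+ # 2 :* # 0)))
              := (# 1 :+ α :+ # 0) :* (# 2 :+ α :+ # 0) :* (# 3 :* # 0 :+ # 1 :+ α :+ β)) refl α β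
  Ŝ-shift α β (suc n) = begin
    a * b * (s' * δ' + M' * ℓ') + - (M * c₁)
      ≡⟨ solve 8 (λ a b s d M' l M c →
              a :* b :* (s :* d :+ M' :* l) :+ :- (M :* c)
              := (a :* b :* s) :* d :+ b :* a :* M' :* l :- M :* c) refl a b s' δ' M' ℓ' M c₁ ⟩
    a * b * s' * δ' + b * a * M' * ℓ' - M * c₁
      ≡⟨ cong₂ (λ u v → u * δ' + v * ℓ' - M * c₁) ih (numer-shift α β (suc n)) ⟩
    ((1# + α + ι n) * (ι 2 + α + ι n) * s - M) * δ' + (1# + α + ι 2 * ι (suc n)) * (1# + α + β + ι 2 * ι (suc n)) * M * ℓ' - M * c₁
      ≡⟨ cong (λ J → ((1# + α + ι n) * (ι 2 + α + ι n) * s - M) * δ'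
               + (1# + α + ι 2 * J) * (1# + α + β + ι 2 * J) * M * (ι 3 * J + 1# + (α + ι 2) + β)
               - M * ((1# + α + ι 2 * J) * (1# + β + ι 2 * J) * (1# + α + β + ι 2 * J))) (ι-suc n) ⟩
    _ ≡⟨ solve 5 (λ α β N s M →
              ((# 1 :+ α :+ N) :* (# 2 :+ α :+ N) :* s :- M) :* ((# 1 :+ N) :* (# 1 :+ (α :+ # 2) :+ N) :* (# 1 :+ β :+ N))
                :+ (# 1 :+ α :+ # 2 :* (# 1 :+ N)) :* (# 1 :+ α :+ β :+ # 2 :* (# 1 :+ N)) :* M :* (# 3 :* (# 1 :+ N) :+ # 1 :+ (α :+ # 2) :+ β)
                :- M :* ((# 1 :+ α :+ # 2 :* (# 1 :+ N)) :* (# 1 :+ β :+ # 2 :* (# 1 :+ N)) :* (# 1 :+ α :+ β :+ # 2 :* (# 1 :+ N)))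
              := (# 1 :+ α :+ (# 1 :+ N)) :* (# 2 :+ α :+ (# 1 :+ N))
                :* (s :* ((# 1 :+ N) :* (# 1 :+ α :+ N) :* (# 1 :+ β :+ N)) :+ M :* (# 3 :* (# 1 :+ N) :+ # 1 :+ α :+ β))) refl α β (ι n) s M ⟩
    _ ≡⟨ cong (λ J → (1# + α + J) * (ι 2 + α + J) * (s * δ α β n + M * (ι 3 * J + 1# + α + β))) (ι-suc n) ⟨
    (1# + α + ι (suc n)) * (ι 2 + α + ι (suc n)) * Ŝ α β (suc n) ∎
    where
    a = 1# + α + β
    b = 1# + α
    s' = Ŝ (α + ι 2) β n
    s = Ŝ α β n
    δ' = δ (α + ι 2) β n
    M' = numer (α + ι 2) β (suc n)
    M = numer α β (suc n)
    ℓ' = ℓ (α + ι 2) β (suc n)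
    c₁ = (1# + α + ι 2 * ι (suc n)) * (1# + β + ι 2 * ι (suc n)) * (1# + α + β + ι 2 * ι (suc n))
    ih : a * b * s' ≡ (1# + α + ι n) * (ι 2 + α + ι n) * s - M
    ih = trans (solve 2 (λ x M → x := x :+ M :- M) refl (a * b * s') M) (cong (_- M) (Ŝ-shift α β n))

  -- Termination through the factor (½+α/2)ₙ, i.e. 1 + α = -2j.
  Ŝ-terminating-α : ∀ β j → Ŝ (- (ι 3 + ι 2 * ι j)) β (suc j)
    ≡ ι 2 * (1# + ι j) * (β - ι 2 - ι 2 * ι j) * (1# + β + ι j) * Ŝ (- (1# + ι 2 * ι j)) β j
  Ŝ-terminating-α β j = begin
    Ŝ α β j * δ α β j + M * ℓ α β (suc j)
      ≡⟨ cong (λ J → Ŝ α β j * δ α β j + M * (ι 3 * J + 1# + α + β)) (ι-suc j) ⟩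
    s * ((1# + N) * (1# + α + N) * (1# + β + N)) + M * (ι 3 * (1# + N) + 1# + α + β)
      ≡⟨ solve 4 (λ N β s M →
              s :* ((# 1 :+ N) :* (# 1 :+ :- (# 3 :+ # 2 :* N) :+ N) :* (# 1 :+ β :+ N)) :+ M :* (# 3 :* (# 1 :+ N) :+ # 1 :+ :- (# 3 :+ # 2 :* N) :+ β)
              := (# 1 :+ β :+ N) :* (M :- (# 1 :+ :- (# 3 :+ # 2 :* N) :+ N) :* (# 2 :+ :- (# 3 :+ # 2 :* N) :+ N) :* s)) refl N β s M ⟩
    (1# + β + N) * (M - (1# + α + N) * (ι 2 + α + N) * s)
      ≡⟨ cong (λ u → (1# + β + N) * (M - u)) (Ŝ-shift α β j) ⟨
    (1# + β + N) * (M - ((1# + α + β) * (1# + α) * Ŝ (α + ι 2) β j + M))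
      ≡⟨ cong (λ u → (1# + β + N) * (M - ((1# + α + β) * (1# + α) * Ŝ u β j + M)))
           (solve 1 (λ N → :- (# 3 :+ # 2 :* N) :+ # 2 := :- (# 1 :+ # 2 :* N)) refl N) ⟩
    (1# + β + N) * (M - ((1# + α + β) * (1# + α) * s₀ + M))
      ≡⟨ solve 4 (λ N β s₀ M →
              (# 1 :+ β :+ N) :* (M :- ((# 1 :+ :- (# 3 :+ # 2 :* N) :+ β) :* (# 1 :+ :- (# 3 :+ # 2 :* N)) :* s₀ :+ M))
              := # 2 :* (# 1 :+ N) :* (β :- # 2 :- # 2 :* N) :* (# 1 :+ β :+ N) :* s₀) refl N β s₀ M ⟩
    ι 2 * (1# + ι j) * (β - ι 2 - ι 2 * ι j) * (1# + β + ι j) * s₀ ∎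
    where
    N = ι j
    α = - (ι 3 + ι 2 * N)
    s = Ŝ α β j
    M = numer α β (suc j)
    s₀ = Ŝ (- (1# + ι 2 * ι j)) β j

  -- Termination through the factor (½+(α+β)/2)ₙ, i.e. 1 + α + β = -2j.
  Ŝ-terminating-α+β : ∀ β j → Ŝ (- (1# + β + ι 2 * ι j)) β j ≡ 0#
  Ŝ-terminating-α+β β zero = solve 1 (λ β → # 3 :* # 0 :+ # 1 :+ :- (# 1 :+ β :+ # 2 :* # 0) :+ β := # 0) refl β
  Ŝ-terminating-α+β β (suc j) = begin
    Ŝ (- (1# + β + ι 2 * ι (suc j))) β (suc j)
      ≡⟨ cong (λ u → Ŝ (- (1# + β + ι 2 * u)) β (suc j)) (ι-suc j) ⟩
    Ŝ α β j * δ α β j + M * ℓ α β (suc j)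
      ≡⟨ cong₂ (λ u J → s * δ α β j + u * (ι 3 * J + 1# + α + β)) M≡ (ι-suc j) ⟩
    s * ((1# + N) * (1# + α + N) * (1# + β + N)) + (1# + α + N) * (ι 2 + α + N) * s * (ι 3 * (1# + N) + 1# + α + β)
      ≡⟨ solve 3 (λ N β s →
              s :* ((# 1 :+ N) :* (# 1 :+ :- (# 1 :+ β :+ # 2 :* (# 1 :+ N)) :+ N) :* (# 1 :+ β :+ N))
                :+ (# 1 :+ :- (# 1 :+ β :+ # 2 :* (# 1 :+ N)) :+ N) :* (# 2 :+ :- (# 1 :+ β :+ # 2 :* (# 1 :+ N)) :+ N) :* s
                :* (# 3 :* (# 1 :+ N) :+ # 1 :+ :- (# 1 :+ β :+ # 2 :* (# 1 :+ N)) :+ β)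
              := # 0) refl N β s ⟩
    0# ∎
    where
    N = ι j
    α = - (1# + β + ι 2 * (1# + N))
    s = Ŝ α β j
    M = numer α β (suc j)
    M≡ : M ≡ (1# + α + N) * (ι 2 + α + N) * s
    M≡ = begin
      M                                                 ≡⟨ solve 2 (λ x M → M := x :* # 0 :+ M) refl ((1# + α + β) * (1# + α)) M ⟩
      (1# + α + β) * (1# + α) * 0# + M                  ≡⟨ cong (λ u → (1# + α + β) * (1# + α) * u + M) (Ŝ-terminating-α+β β j) ⟨
      (1# + α + β) * (1# + α) * Ŝ (- (1# + β + ι 2 * N)) β j + M
        ≡⟨ cong (λ u → (1# + α + β) * (1# + α) * Ŝ u β j + M)
             (solve 2 (λ β N → :- (# 1 :+ β :+ # 2 :* N) := :- (# 1 :+ β :+ # 2 :* (# 1 :+ N)) :+ # 2) refl β N) ⟩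
      (1# + α + β) * (1# + α) * Ŝ (α + ι 2) β j + M      ≡⟨ Ŝ-shift α β j ⟩
      (1# + α + N) * (ι 2 + α + N) * s ∎


  -- Products and the closed form of the terminating sums

  prod : (ℕ → A) → ℕ → A
  prod f zero = 1#
  prod f (suc n) = prod f n * f n

  prod-cong : ∀ {f g} → (∀ i → f i ≡ g i) → ∀ n → prod f n ≡ prod g n
  prod-cong f≡g zero = refl
  prod-cong f≡g (suc n) = cong₂ _*_ (prod-cong f≡g n) (f≡g n)

  prod-* : ∀ f g n → prod (λ i → f i * g i) n ≡ prod f n * prod g n
  prod-* f g zero = sym (*-identityˡ _)
  prod-* f g (suc n) = trans (cong (_* (f n * g n)) (prod-* f g n))
    (solve 4 (λ a b x y → a :* b :* (x :* y) := a :* x :* (b :* y)) refl (prod f n) (prod g n) (f n) (g n))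

  prod-neg : ∀ f n → prod (λ i → - f i) n ≡ (- 1#) ^ n * prod f n
  prod-neg f zero = sym (*-identityˡ _)
  prod-neg f (suc n) = trans (cong (_* - f n) (prod-neg f n))
    (solve 3 (λ a b x → a :* b :* :- x := a :* :- # 1 :* (b :* x)) refl ((- 1#) ^ n) (prod f n) (f n))

  prod-suc : ∀ f n → prod f (suc n) ≡ f 0 * prod (λ i → f (suc i)) n
  prod-suc f zero = *-comm _ _
  prod-suc f (suc n) = trans (cong (_* f (suc n)) (prod-suc f n)) (*-assoc _ _ _)

  falling : A → ℕ → A
  falling x = prod (λ i → x - ι i)

  falling-suc : ∀ x n → falling x (suc n) ≡ x * falling (x - 1#) n
  falling-suc x n = trans (prod-suc (λ i → x - ι i) n)
    (cong₂ _*_ (solve 1 (λ x → x :- # 0 := x) refl x)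
      (prod-cong (λ i → trans (cong (λ u → x - u) (ι-suc i)) (solve 2 (λ x N → x :- (# 1 :+ N) := x :- # 1 :- N) refl x (ι i))) n))

  oddFactor : ℕ → ℕ → A
  oddFactor m i = ι 2 * (1# + ι 2 * ι m - ι 2 - ι 2 * ι i)

  -- Both sides are (2m)!/m!: the factors 2(2m-1-2i) multiply to 2ᵐ (2m-1)!!.
  falling[2m]m : ∀ m → falling (ι 2 * ι m) m ≡ prod (oddFactor m) m
  falling[2m]m zero = refl
  falling[2m]m (suc m) = begin
    b                                        ≡⟨ *-identityʳ b ⟨
    b * 1#                                   ≡⟨ cong (b *_) (rec-inverse m) ⟨
    -- With M = m+1, the factor `2 * M - M` is the next one of the falling product, which grows to
    -- length m+2. Two factors can then be peeled off in front, leaving the falling product for m.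
    b * (ι (suc m) * z)                      ≡⟨ solve 3 (λ b M z → b :* (M :* z) := b :* (# 2 :* M :- M) :* z) refl b (ι (suc m)) z ⟩
    falling (ι 2 * ι (suc m)) (2 ℕ.+ m) * z  ≡⟨ cong (_* z) peel₂ ⟩
    (ι 2 * ι (suc m)) * ((ι 2 * ι (suc m) - 1#) * falling (ι 2 * ι m) m) * z
      ≡⟨ solve 4 (λ M x f z → # 2 :* M :* (x :* f) :* z := # 2 :* x :* f :* (M :* z)) refl (ι (suc m)) (ι 2 * ι (suc m) - 1#) (falling (ι 2 * ι m) m) z ⟩
    ι 2 * (ι 2 * ι (suc m) - 1#) * falling (ι 2 * ι m) m * (ι (suc m) * z)
      ≡⟨ cong₂ (λ u v → ι 2 * (ι 2 * ι (suc m) - 1#) * u * v) (falling[2m]m m) (rec-inverse m) ⟩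
    ι 2 * (ι 2 * ι (suc m) - 1#) * prod (oddFactor m) m * 1#
      ≡⟨ solve 2 (λ M a →
              # 2 :* (# 2 :* M :- # 1) :* a :* # 1
              := # 2 :* (# 1 :+ # 2 :* M :- # 2 :- # 2 :* # 0) :* a) refl (ι (suc m)) _ ⟩
    oddFactor (suc m) 0 * prod (oddFactor m) m
      ≡⟨ cong (oddFactor (suc m) 0 *_) (prod-cong shift m) ⟩
    oddFactor (suc m) 0 * prod (λ i → oddFactor (suc m) (suc i)) m
      ≡⟨ prod-suc (oddFactor (suc m)) m ⟨
    prod (oddFactor (suc m)) (suc m) ∎
    where
    z = rec (suc m)
    b = falling (ι 2 * ι (suc m)) (suc m)
    shift : ∀ i → oddFactor m i ≡ oddFactor (suc m) (suc i)
    shift i = trans (solve 2 (λ M i →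
              # 2 :* (# 1 :+ # 2 :* M :- # 2 :- # 2 :* i)
              := # 2 :* (# 1 :+ # 2 :* (# 1 :+ M) :- # 2 :- # 2 :* (# 1 :+ i))) refl (ι m) (ι i))
      (sym (cong₂ (λ u v → ι 2 * (1# + ι 2 * u - ι 2 - ι 2 * v)) (ι-suc m) (ι-suc i)))
    peel₂ : falling (ι 2 * ι (suc m)) (2 ℕ.+ m) ≡ ι 2 * ι (suc m) * ((ι 2 * ι (suc m) - 1#) * falling (ι 2 * ι m) m)
    peel₂ = trans (falling-suc _ (suc m)) (cong (ι 2 * ι (suc m) *_)
      (trans (falling-suc _ m) (cong (λ u → (ι 2 * ι (suc m) - 1#) * falling u m)
        (trans (cong (λ u → ι 2 * u - 1# - 1#) (ι-suc m)) (solve 1 (λ M → # 2 :* (# 1 :+ M) :- # 1 :- # 1 := # 2 :* M) refl (ι m))))))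

  -- Iterates `Ŝ-terminating-α` down to α = -1, where the sum is the single term β.
  Ŝ-product : ∀ β j → Ŝ (- (1# + ι 2 * ι j)) β j
    ≡ β * prod (λ i → ι 2 * (1# + ι i) * (β - ι 2 - ι 2 * ι i) * (1# + β + ι i)) j
  Ŝ-product β zero = solve 1 (λ β → # 3 :* # 0 :+ # 1 :+ :- (# 1 :+ # 2 :* # 0) :+ β := β :* # 1) refl β
  Ŝ-product β (suc j) = begin
    Ŝ (- (1# + ι 2 * ι (suc j))) β (suc j)
      ≡⟨ cong (λ u → Ŝ u β (suc j)) (trans (cong (λ u → - (1# + ι 2 * u)) (ι-suc j)) (solve 1 (λ N → :- (# 1 :+ # 2 :* (# 1 :+ N)) := :- (# 3 :+ # 2 :* N)) refl (ι j))) ⟩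
    Ŝ (- (ι 3 + ι 2 * ι j)) β (suc j)
      ≡⟨ Ŝ-terminating-α β j ⟩
    c * Ŝ (- (1# + ι 2 * ι j)) β j
      ≡⟨ cong (c *_) (Ŝ-product β j) ⟩
    c * (β * prod f j)
      ≡⟨ solve 3 (λ c b f → c :* (b :* f) := b :* (f :* c)) refl c β _ ⟩
    β * (prod f j * c) ∎
    where
    f : ℕ → A
    f i = ι 2 * (1# + ι i) * (β - ι 2 - ι 2 * ι i) * (1# + β + ι i)
    c = f j

  -- The product of `Ŝ-product` and the denominator share (1+i)(1+P+i). The remaining factors
  -- 2(P-2-2i) multiply to (2m)!/m!, while 1-P+i = -(2m-i) gives the same product up to the sign
  -- (-1)ᵐ.
  Ŝ-symmetric : ∀ m → let P = 1# + ι 2 * ι m in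
    Ŝ (- P) P m ≡ (- 1#) ^ m * P * prod (δ (- P) P) m
  Ŝ-symmetric m = begin
    Ŝ (- P) P m
      ≡⟨ Ŝ-product P m ⟩
    P * prod (λ i → ι 2 * (1# + ι i) * (P - ι 2 - ι 2 * ι i) * (1# + P + ι i)) m
      ≡⟨ cong (P *_) (trans (prod-cong (λ i → solve 3 (λ a b c → # 2 :* a :* b :* c := a :* c :* (# 2 :* b)) refl (1# + ι i) (P - ι 2 - ι 2 * ι i) (1# + P + ι i)) m)
                            (prod-* common (oddFactor m) m)) ⟩
    P * (prod common m * prod (oddFactor m) m)
      ≡⟨ cong (λ u → P * (prod common m * u)) (trans (sym (falling[2m]m m)) (sym (sign-cancel m))) ⟩
    P * (prod common m * ((- 1#) ^ m * ((- 1#) ^ m * falling (ι 2 * ι m) m)))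
      ≡⟨ solve 4 (λ P c s f → P :* (c :* (s :* (s :* f))) := s :* P :* (c :* (s :* f))) refl P (prod common m) ((- 1#) ^ m) (falling (ι 2 * ι m) m) ⟩
    (- 1#) ^ m * P * (prod common m * ((- 1#) ^ m * falling (ι 2 * ι m) m))
      ≡⟨ cong (λ u → (- 1#) ^ m * P * (prod common m * u)) (prod-neg (λ i → ι 2 * ι m - ι i) m) ⟨
    (- 1#) ^ m * P * (prod common m * prod (λ i → - (ι 2 * ι m - ι i)) m)
      ≡⟨ cong ((- 1#) ^ m * P *_) (trans (sym (prod-* common _ m)) (prod-cong
           (λ i → solve 2 (λ i M →
              (# 1 :+ i) :* (# 1 :+ (# 1 :+ # 2 :* M) :+ i) :* :- (# 2 :* M :- i)
              := (# 1 :+ i) :* (# 1 :+ :- (# 1 :+ # 2 :* M) :+ i) :* (# 1 :+ (# 1 :+ # 2 :* M) :+ i)) refl (ι i) (ι m)) m)) ⟩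
    (- 1#) ^ m * P * prod (δ (- P) P) m ∎
    where
    P = 1# + ι 2 * ι m
    common : ℕ → A
    common i = (1# + ι i) * (1# + P + ι i)
    sign-cancel : ∀ n {x} → (- 1#) ^ n * ((- 1#) ^ n * x) ≡ x
    sign-cancel zero {x} = solve 1 (λ x → # 1 :* (# 1 :* x) := x) refl x
    sign-cancel (suc n) {x} = trans (solve 2 (λ s x → s :* :- # 1 :* (s :* :- # 1 :* x) := s :* (s :* x)) refl ((- 1#) ^ n) x) (sign-cancel n)

  -- The summand itself, once inverses κ of the denominator factors are chosen.
  T : A → A → (ℕ → A) → ℕ → A
  T α β κ n = prod κ n * numer α β n

  sum-T : ∀ α β κ N → (∀ i → i ℕ.< N → δ α β i * κ i ≡ 1#) →
          sum N (λ n → T α β κ n * ℓ α β n) ≡ prod κ N * Ŝ α β N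
  sum-T α β κ zero inv = solve 1 (λ l → # 1 :* # 1 :* l := # 1 :* l) refl (ℓ α β 0)
  sum-T α β κ (suc N) inv = begin
    sum N (λ n → T α β κ n * ℓ α β n) + T α β κ (suc N) * ℓ α β (suc N)
      ≡⟨ cong (_+ T α β κ (suc N) * ℓ α β (suc N)) (sum-T α β κ N (λ i i<N → inv i (ℕₚ.m<n⇒m<1+n i<N))) ⟩
    k * Ŝ α β N + k * κ N * M * l
      ≡⟨ cong (_+ k * κ N * M * l) (trans (sym (*-identityʳ _)) (cong (k * Ŝ α β N *_) (sym (inv N (ℕₚ.n<1+n N))))) ⟩
    k * Ŝ α β N * (δ α β N * κ N) + k * κ N * M * l
      ≡⟨ solve 6 (λ k s d c M l → k :* s :* (d :* c) :+ k :* c :* M :* l := k :* c :* (s :* d :+ M :* l)) refl k (Ŝ α β N) (δ α β N) (κ N) M l ⟩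
    k * κ N * Ŝ α β (suc N) ∎
    where
    k = prod κ N
    M = numer α β (suc N)
    l = ℓ α β (suc N)

  prod-inverse : ∀ f κ N → (∀ i → i ℕ.< N → f i * κ i ≡ 1#) → prod κ N * prod f N ≡ 1#
  prod-inverse f κ zero inv = *-identityˡ _
  prod-inverse f κ (suc N) inv = begin
    prod κ N * κ N * (prod f N * f N)
      ≡⟨ solve 4 (λ a b c d → a :* b :* (c :* d) := a :* c :* (d :* b)) refl (prod κ N) (κ N) (prod f N) (f N) ⟩
    prod κ N * prod f N * (f N * κ N)
      ≡⟨ cong₂ _*_ (prod-inverse f κ N (λ i i<N → inv i (ℕₚ.m<n⇒m<1+n i<N))) (inv N (ℕₚ.n<1+n N)) ⟩
    1# * 1#   ≡⟨ *-identityˡ _ ⟩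
    1# ∎

  sum-T-symmetric : ∀ m κ → let P = 1# + ι 2 * ι m in
    (∀ i → i ℕ.< m → δ (- P) P i * κ i ≡ 1#) →
    sum m (λ n → T (- P) P κ n * ℓ (- P) P n) ≡ (- 1#) ^ m * P
  sum-T-symmetric m κ inv = begin
    sum m (λ n → T (- P) P κ n * ℓ (- P) P n)   ≡⟨ sum-T (- P) P κ m inv ⟩
    prod κ m * Ŝ (- P) P m                      ≡⟨ cong (prod κ m *_) (Ŝ-symmetric m) ⟩
    prod κ m * (s * prod (δ (- P) P) m)         ≡⟨ solve 3 (λ k s d → k :* (s :* d) := s :* (k :* d)) refl (prod κ m) s (prod (δ (- P) P) m) ⟩
    s * (prod κ m * prod (δ (- P) P) m)         ≡⟨ cong (s *_) (prod-inverse (δ (- P) P) κ m inv) ⟩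
    s * 1#                                      ≡⟨ *-identityʳ s ⟩
    s ∎
    where
    P = 1# + ι 2 * ι m
    s = (- 1#) ^ m * P

  sum-T-vanish : ∀ β m κ → let α = - (1# + β + ι 2 * ι m) in
    (∀ i → i ℕ.< m → δ α β i * κ i ≡ 1#) → sum m (λ n → T α β κ n * ℓ α β n) ≡ 0#
  sum-T-vanish β m κ inv = trans (sum-T _ β κ m inv)
    (trans (cong (prod κ m *_) (Ŝ-terminating-α+β β m)) (zeroʳ _))


  -- Divisibility by powers of p among p-integral elements

  module Local
    (m : ℕ) (0<m : 0 ℕ.< m)
    (Z : A → Set) (Z-1 : Z 1#)
    (Z-+ : ∀ {x y} → Z x → Z y → Z (x + y))
    (Z-* : ∀ {x y} → Z x → Z y → Z (x * y))
    (Z-neg : ∀ {x} → Z x → Z (- x))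
    (Z-rec : ∀ n → ¬ (suc (m ℕ.+ m) ∣ n) → Z (rec n))
    where

    p : ℕ
    p = suc (m ℕ.+ m)

    -- The prime as an element of `A`, in terms of m so that the solver sees the relation between p
    -- and m. Primality itself enters through the closure properties of `Z`.
    P : A
    P = 1# + ι 2 * ι m

    ι-p : ι p ≡ P
    ι-p = trans (ι-suc (m ℕ.+ m)) (cong (1# +_) (trans (ι-+ m m) (solve 1 (λ M → M :+ M := # 2 :* M) refl (ι m))))

    Z-rec< : ∀ {n} → suc n ℕ.< p → Z (rec (suc n))
    Z-rec< {n} n<p = Z-rec (suc n) (>⇒∤ n<p)

    Z-0 : Z 0#
    Z-0 = subst Z (-‿inverseʳ 1#) (Z-+ Z-1 (Z-neg Z-1))

    Z-ι : ∀ n → Z (ι n)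
    Z-ι zero = Z-0
    Z-ι (suc n) = subst Z (sym (ι-suc n)) (Z-+ Z-1 (Z-ι n))

    Z-P : Z P
    Z-P = subst Z ι-p (Z-ι p)

    Z-- : ∀ {x y} → Z x → Z y → Z (x - y)
    Z-- zx zy = Z-+ zx (Z-neg zy)

    Z-^ : ∀ {x} n → Z x → Z (x ^ n)
    Z-^ zero _ = Z-1
    Z-^ (suc n) zx = Z-* (Z-^ n zx) zx

    -- D k x: x lies in pᵏ ℤ₍ₚ₎.
    record D (k : ℕ) (x : A) : Set where
      constructor multiple
      field
        quotient : A
        Z-quotient : Z quotient
        equation : x ≡ P ^ k * quotient

    D⇒Z : ∀ {k x} → D k x → Z x
    D⇒Z {k} (multiple y zy refl) = Z-* (Z-^ k Z-P) zy

    Z⇒D : ∀ {x} → Z x → D 0 x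
    Z⇒D {x} zx = multiple x zx (sym (*-identityˡ x))

    D-0 : ∀ {k} → D k 0#
    D-0 = multiple 0# Z-0 (sym (zeroʳ _))

    D-P : D 1 P
    D-P = multiple 1# Z-1 (solve 1 (λ P → P := # 1 :* P :* # 1) refl P)

    D-+ : ∀ {k x y} → D k x → D k y → D k (x + y)
    D-+ (multiple x zx refl) (multiple y zy refl) = multiple (x + y) (Z-+ zx zy) (sym (distribˡ _ x y))

    D-neg : ∀ {k x} → D k x → D k (- x)
    D-neg (multiple x zx refl) = multiple (- x) (Z-neg zx) (-‿distribʳ-* _ x)

    D-- : ∀ {k x y} → D k x → D k y → D k (x - y)
    D-- dx dy = D-+ dx (D-neg dy)

    D-* : ∀ {j k x y} → D j x → D k y → D (j ℕ.+ k) (x * y)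
    D-* {j} {k} (multiple x zx refl) (multiple y zy refl) = multiple (x * y) (Z-* zx zy)
      (trans (solve 4 (λ a x b y → a :* x :* (b :* y) := a :* b :* (x :* y)) refl (P ^ j) x (P ^ k) y) (cong (_* (x * y)) (sym (^-+ P j k))))

    Z-*-D : ∀ {k x y} → Z x → D k y → D k (x * y)
    Z-*-D zx dy = D-* (Z⇒D zx) dy

    D-*-Z : ∀ {k x y} → D k x → Z y → D k (x * y)
    D-*-Z dx zy = subst (D _) (*-comm _ _) (Z-*-D zy dx)

    D-^ : ∀ {x} n → D 1 x → D n (x ^ n)
    D-^ zero _ = Z⇒D Z-1
    D-^ (suc n) dx = subst (D (suc n)) (*-comm _ _) (D-* dx (D-^ n dx))

    D-suc : ∀ {k x y} → D k x → D 1 y → D (suc k) (x * y)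
    D-suc dx dy = subst (D _) (*-comm _ _) (D-* dy dx)

    D-weaken : ∀ {j k x} → j ℕ.≤ k → D k x → D j x
    D-weaken {j} j≤k (multiple y zy eq) with ℕₚ.m≤n⇒∃[o]m+o≡n j≤k
    ... | o , refl = multiple (P ^ o * y) (Z-* (Z-^ o Z-P) zy) (trans eq (trans (cong (_* y) (^-+ P j o)) (*-assoc _ _ _)))

    D-trans : ∀ {k x y z} → D k (x - y) → D k (y - z) → D k (x - z)
    D-trans {x = x} {y} {z} d e = subst (D _) (solve 3 (λ x y z → x :- y :+ (y :- z) := x :- z) refl x y z) (D-+ d e)

    D-*-cong : ∀ {k x x' y y'} → Z x' → Z y → D k (x - x') → D k (y - y') → D k (x * y - x' * y')
    D-*-cong {k} {x} {x'} {y} {y'} zx' zy dx dy =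
      subst (D k) (solve 4 (λ x u y v → (x :- u) :* y :+ u :* (y :- v) := x :* y :- u :* v) refl x x' y y')
        (D-+ (D-*-Z dx zy) (Z-*-D zx' dy))

    D-^-cong : ∀ {k x y} n → Z x → Z y → D k (x - y) → D k (x ^ n - y ^ n)
    D-^-cong zero _ _ _ = subst (D _) (sym (-‿inverseʳ 1#)) D-0
    D-^-cong (suc n) zx zy d = D-*-cong (Z-^ n zy) zx (D-^-cong n zx zy d) d

    D-sum-tail : ∀ {k f} M N → (∀ n → M ℕ.< n → n ℕ.≤ N → D k (f n)) → M ℕ.≤ N → D k (sum N f - sum M f)
    D-sum-tail M N d M≤N with ℕₚ.m≤n⇒m<n∨m≡n M≤N
    D-sum-tail M N d M≤N | inj₂ refl = subst (D _) (sym (-‿inverseʳ _)) D-0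
    D-sum-tail {f = f} M (suc N) d M≤N | inj₁ (ℕ.s≤s M≤N') =
      subst (D _) (solve 3 (λ a b c → a :- b :+ c := a :+ c :- b) refl (sum N f) (sum M f) (f (suc N)))
        (D-+ (D-sum-tail M N (λ n M<n n≤N → d n M<n (ℕₚ.m≤n⇒m≤1+n n≤N)) M≤N') (d (suc N) (ℕ.s≤s M≤N') ℕₚ.≤-refl))

    half : A
    half = rec 2

    2half : ι 2 * half ≡ 1#
    2half = rec-inverse 1

    2<p : 2 ℕ.< p
    2<p = ℕ.s≤s (ℕₚ.+-mono-≤ 0<m 0<m)

    Z-half : Z half
    Z-half = Z-rec< 2<p

    -- The factor of (½)ₙ with index m is p/2; the tails of all three sums are small because of it.
    half+m : half + ι m ≡ P * half
    half+m = trans (solve 2 (λ h M → h :+ M := h :+ M :* # 1) refl half (ι m)) (trans (cong (λ u → half + ι m * u) (sym 2half))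
      (solve 2 (λ h M → h :+ M :* (# 2 :* h) := (# 1 :+ # 2 :* M) :* h) refl half (ι m)))

    D-half+m : D 1 (half + ι m)
    D-half+m = subst (D 1) (sym half+m) (D-*-Z D-P Z-half)

    m<p : m ℕ.< p
    m<p = ℕ.s≤s (ℕₚ.m≤m+n m m)

    Z-q : ∀ {τ n} → Z τ → n ℕ.< p → Z (q τ n)
    Z-q {n = zero} zτ _ = Z-1
    Z-q {n = suc n} zτ n<p = Z-* (Z-* (Z-q zτ (ℕₚ.<⇒≤ n<p)) (Z-+ zτ (Z-ι n))) (Z-rec< n<p)

    D-q : ∀ {τ j n} → Z τ → j ℕ.< n → n ℕ.< p → D 1 (τ + ι j) → D 1 (q τ n)
    D-q {τ} {j} {suc n} zτ (ℕ.s≤s j≤n) n<p d with ℕₚ.m≤n⇒m<n∨m≡n j≤n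
    ... | inj₁ j<n = D-*-Z (D-*-Z (D-q zτ j<n (ℕₚ.<⇒≤ n<p) d) (Z-+ zτ (Z-ι n))) (Z-rec< n<p)
    ... | inj₂ refl = D-*-Z (Z-*-D (Z-q zτ (ℕₚ.<⇒≤ n<p)) d) (Z-rec< n<p)

    Z-weight : ∀ {ε} n → Z ε → n ℕ.< p → Z (weight ε n)
    Z-weight zero _ _ = Z-1
    Z-weight (suc n) zε n<p = Z-* (Z-* (Z-* (Z-weight n zε (ℕₚ.<⇒≤ n<p)) zε) (Z-rec< n<p))
      (Z-+ (Z-* (Z-ι 4) (Z-ι n)) (Z-ι 2))

    -- The factor 4m+2 = 2p enters at n = m+1, and no denominator below p can cancel it.
    D-weight : ∀ {ε} n → Z ε → m ℕ.< n → n ℕ.< p → D 1 (weight ε n)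
    D-weight (suc n) zε (ℕ.s≤s m≤n) n<p with ℕₚ.m≤n⇒m<n∨m≡n m≤n
    ... | inj₁ m<n = D-*-Z (D-*-Z (D-*-Z (D-weight n zε m<n (ℕₚ.<⇒≤ n<p)) zε) (Z-rec< n<p))
                       (Z-+ (Z-* (Z-ι 4) (Z-ι n)) (Z-ι 2))
    ... | inj₂ refl = Z-*-D (Z-* (Z-* (Z-weight n zε m<p) zε) (Z-rec< n<p))
                       (subst (D 1) (solve 1 (λ M → (# 1 :+ # 2 :* M) :* # 2 := # 4 :* M :+ # 2) refl (ι m)) (D-*-Z D-P (Z-ι 2)))

    -- (τ)ₙ/n! = τ/n · (1 + O(p)) when p divides τ.
    q-small : ∀ {τ} n → D 1 τ → suc n ℕ.< p →
              Σ A λ u → Z u × q τ (suc n) ≡ τ * u × D 1 (u - rec (suc n))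
    q-small {τ} zero dτ n<p = rec 1 , Z-rec< n<p , solve 2 (λ τ z → # 1 :* (τ :+ # 0) :* z := τ :* z) refl τ (rec 1) ,
      subst (D 1) (sym (-‿inverseʳ _)) D-0
    q-small {τ} (suc n) dτ n<p with q-small n dτ (ℕₚ.<⇒≤ n<p)
    ... | u , zu , eq , du =
      u * (τ + ι (suc n)) * rec (2 ℕ.+ n) ,
      Z-* (Z-* zu (Z-+ (D⇒Z dτ) (Z-ι (suc n)))) (Z-rec< n<p) ,
      trans (cong (λ v → v * (τ + ι (suc n)) * rec (2 ℕ.+ n)) eq)
            (solve 4 (λ τ u x z → τ :* u :* x :* z := τ :* (u :* x :* z)) refl τ u (τ + ι (suc n)) (rec (2 ℕ.+ n))) ,
      subst (D 1) difference (Z-*-D (Z-rec< n<p) (D-+ (Z-*-D zu dτ) (D-*-Z du (Z-ι (suc n)))))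
      where
      difference : rec (2 ℕ.+ n) * (u * τ + (u - rec (suc n)) * ι (suc n)) ≡ u * (τ + ι (suc n)) * rec (2 ℕ.+ n) - rec (2 ℕ.+ n)
      difference = trans
        (solve 5 (λ y u τ z N → y :* (u :* τ :+ (u :- z) :* N) := u :* (τ :+ N) :* y :- y :* (N :* z)) refl (rec (2 ℕ.+ n)) u τ (rec (suc n)) (ι (suc n)))
        (trans (cong (λ v → u * (τ + ι (suc n)) * rec (2 ℕ.+ n) - rec (2 ℕ.+ n) * v) (rec-inverse n))
               (cong (λ v → u * (τ + ι (suc n)) * rec (2 ℕ.+ n) - v) (*-identityʳ _)))

    -- The supercongruence attached to a WZ pair

    module WZ-Local
      (ε : A) (ε² : ε * ε ≡ 1#) (Z-ε : Z ε) (e : ℕ) (0^e : 0# ^ e ≡ 0#)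
      (even : ∀ x → (- x) ^ e ≡ x ^ e) (L g : A → A → A)
      (certificate₀ : ∀ τ → L 0# (τ + 1#) ≡ L 0# τ + ι 2 * g 0# τ)
      (certificate : ∀ N τ →
        (τ + (1# + N)) ^ e * L (1# + N) (τ + 1#) + ε * ((1# + N) ^ e * (1# + N)) * g N τ
        ≡ τ ^ e * L (1# + N) τ + (ι 4 * (1# + N) + ι 2) * g (1# + N) τ * (τ + (1# + N)) ^ e)
      (L₀₀ : L 0# 0# ≡ 0#)
      (Z-L : ∀ {x τ} → Z x → Z τ → Z (L x τ))
      (Z-g : ∀ {x τ} → Z x → Z τ → Z (g x τ))
      (D-L : ∀ {x τ} → Z x → D 1 τ → D 1 (L x τ - L x 0#))
      where

      open WZ ε ε² e L g certificate₀ certificate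

      ω : ℕ → A
      ω n = weight ε (suc n) * rec (suc n) ^ e * L (ι (suc n)) 0#

      W : ℕ → A
      W zero = 0#
      W (suc n) = W n + ω n

      -- When p divides τ, each term with n > 0 carries τᵉ, hence pᵉ. The cofactor matters only
      -- modulo p, and there (τ)ₙ/n! becomes τ/n and L(n,τ) becomes L(n,0).
      S-small : ∀ {τ} N → D 1 τ → N ℕ.< p → D (suc e) (S τ N - (L 0# τ + τ ^ e * W N))
      S-small {τ} zero dτ _ = subst (D _) (sym (trans
        (cong (λ u → 1# * u * L 0# τ - (L 0# τ + τ ^ e * 0#)) (1^n≡1 e))
        (solve 2 (λ l t → # 1 :* # 1 :* l :- (l :+ t :* # 0) := # 0) refl (L 0# τ) (τ ^ e)))) D-0
      S-small {τ} (suc N) dτ N<p with q-small N dτ N<p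
      ... | u , zu , eq , du = subst (D (suc e)) rearrange
        (D-+ (S-small N dτ (ℕₚ.<⇒≤ N<p))
             (D-suc (D-^ e dτ) (Z-*-D (Z-weight (suc N) Z-ε N<p)
               (D-*-cong (Z-^ e (Z-rec< N<p)) (Z-L (Z-ι (suc N)) (D⇒Z dτ))
                 (D-^-cong e zu (Z-rec< N<p) du) (D-L (Z-ι (suc N)) dτ)))))
        where
        w = weight ε (suc N)
        x = L (ι (suc N)) τ
        x₀ = L (ι (suc N)) 0#
        z = rec (suc N)
        rearrange : S τ N - (L 0# τ + τ ^ e * W N) + τ ^ e * (w * (u ^ e * x - z ^ e * x₀))
                    ≡ S τ (suc N) - (L 0# τ + τ ^ e * W (suc N))
        rearrange = trans
          (solve 9 (λ s l t v w a x b y →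
              s :- (l :+ t :* v) :+ t :* (w :* (a :* x :- b :* y))
              := s :+ w :* (t :* a) :* x :- (l :+ t :* (v :+ w :* b :* y))) refl
             (S τ N) (L 0# τ) (τ ^ e) (W N) w (u ^ e) x (z ^ e) x₀)
          (cong (λ a → S τ N + w * a * x - (L 0# τ + τ ^ e * W (suc N)))
            (sym (trans (cong (_^ e) eq) (^-distrib-* τ u e))))

      -- At N = p-1 the central binomial coefficient contributes one p, and (½+k+1)_N reaches p/2 at
      -- index m-k-1, contributing e more.
      D-G : ∀ k → k ℕ.< m → D (suc e) (G (half + ι k) (m ℕ.+ m))
      D-G k k<m = subst (D (suc e)) (*-comm _ _) (D-suc (D-^ e dq) (D-*-Z (D-*-Z dw
          (Z-+ (Z-* (Z-ι 4) (Z-ι (m ℕ.+ m))) (Z-ι 2))) (Z-g (Z-ι (m ℕ.+ m)) zτ)))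
        where
        zτ = Z-+ Z-half (Z-ι k)
        dw : D 1 (weight ε (m ℕ.+ m))
        dw = D-weight (m ℕ.+ m) Z-ε (ℕₚ.m<m+n m 0<m) (ℕₚ.n<1+n _)
        dq : D 1 (q (half + ι k + 1#) (m ℕ.+ m))
        dq with ℕₚ.m≤n⇒∃[o]m+o≡n k<m
        ... | j , k+1+j≡m = D-q {j = j} (Z-+ zτ Z-1)
          (ℕₚ.≤-<-trans (subst (j ℕ.≤_) k+1+j≡m (ℕₚ.m≤n+m j (suc k))) (ℕₚ.m<m+n m 0<m)) (ℕₚ.n<1+n _)
          (subst (D 1) (trans (cong (half +_) (trans (cong ι (sym k+1+j≡m)) (trans (ι-+ (suc k) j) (cong (_+ ι j) (ι-suc k)))))
                              (solve 3 (λ h k j → h :+ (# 1 :+ k :+ j) := h :+ k :+ # 1 :+ j) refl half (ι k) (ι j)))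
                       D-half+m)

      S-chain : ∀ k → k ℕ.≤ m → D (suc e) (S (half + ι k) (m ℕ.+ m) - S half (m ℕ.+ m))
      S-chain zero _ = subst (D (suc e)) (sym (trans (cong (λ u → S u (m ℕ.+ m) - S half (m ℕ.+ m)) (+-identityʳ half)) (-‿inverseʳ _))) D-0
      S-chain (suc k) k<m = subst (D (suc e)) rearrange (D-+ (S-chain k (ℕₚ.<⇒≤ k<m)) (D-G k k<m))
        where
        N = m ℕ.+ m
        rearrange : S (half + ι k) N - S half N + G (half + ι k) N ≡ S (half + ι (suc k)) N - S half N
        rearrange = trans (solve 3 (λ a b c → a :- b :+ c := a :+ c :- b) refl _ _ _) (cong (_- S half N)
          (trans (sym (S-shift (half + ι k) N)) (cong (λ u → S u N)
            (trans (solve 2 (λ h k → h :+ k :+ # 1 := h :+ (# 1 :+ k)) refl half (ι k)) (cong (half +_) (sym (ι-suc k)))))))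

      -- The same count of factors p allows the sum up to (p-1)/2 to be extended to p-1.
      D-F-tail : ∀ n → m ℕ.< n → n ℕ.≤ m ℕ.+ m → D (suc e) (F half n)
      D-F-tail n m<n n≤2m = D-*-Z
        (D-* (D-weight n Z-ε m<n (ℕ.s≤s n≤2m)) (D-^ e (D-q Z-half m<n (ℕ.s≤s n≤2m) D-half+m)))
        (Z-L (Z-ι n) Z-half)

      -- The vanishing of S(-p) up to n = p: all terms but the first and the last contribute (-p)ᵉ W.
      D-W : D (suc e) (L 0# (- P) + weight ε p * L P (- P)) → D (suc e) ((- P) ^ e * W (m ℕ.+ m))
      D-W d = subst (D (suc e)) rearrange (D-neg (D-+ (S-small (m ℕ.+ m) (D-neg D-P) (ℕₚ.n<1+n _)) d))
        where
        N = m ℕ.+ m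
        last-term : F (- P) p ≡ weight ε p * L P (- P)
        last-term = trans (cong₂ (λ a b → weight ε p * a * L b (- P))
          (trans (cong (λ u → q (- u) p ^ e) (sym ι-p)) (trans (cong (_^ e) (q[-n]n p)) (sign^e p))) ι-p)
          (cong (_* L P (- P)) (*-identityʳ _))
          where
          sign^e : ∀ n → ((- 1#) ^ n) ^ e ≡ 1#
          sign^e zero = 1^n≡1 e
          sign^e (suc n) = trans (^-distrib-* ((- 1#) ^ n) (- 1#) e)
            (trans (cong₂ _*_ (sign^e n) (trans (even 1#) (1^n≡1 e))) (*-identityˡ _))
        vanish : S (- P) N + weight ε p * L P (- P) ≡ 0#
        vanish = trans (cong (S (- P) N +_) (sym last-term))
          -- `S-at-neg` needs a range that reaches k = p, one beyond the range of `S-small`; hence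
          -- the separate term n = p.
          (subst (λ u → S (- u) p ≡ 0#) ι-p (S-at-neg 0^e L₀₀ p p ℕₚ.≤-refl))
        rearrange : - (S (- P) N - (L 0# (- P) + (- P) ^ e * W N) + (L 0# (- P) + weight ε p * L P (- P))) ≡ (- P) ^ e * W N
        rearrange = trans (solve 4 (λ s l t v → :- (s :- (l :+ t) :+ (l :+ v)) := t :- (s :+ v)) refl (S (- P) N) (L 0# (- P)) ((- P) ^ e * W N) (weight ε p * L P (- P)))
          (trans (cong (λ u → (- P) ^ e * W N - u) vanish) (solve 1 (λ x → x :- # 0 := x) refl _))

      supercongruence : D (suc e) (L 0# (- P) + weight ε p * L P (- P)) → D (suc e) (S half m - L 0# (P * half))
      supercongruence d =
        D-trans (subst (D (suc e)) (solve 2 (λ a b → :- (a :- b) := b :- a) refl _ _) (D-neg (D-sum-tail m (m ℕ.+ m) D-F-tail (ℕₚ.m≤m+n m m))))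
        (D-trans (subst (D (suc e)) (trans (solve 2 (λ a b → :- (a :- b) := b :- a) refl _ _)
            (cong (λ u → S half (m ℕ.+ m) - S u (m ℕ.+ m)) half+m)) (D-neg (S-chain m ℕₚ.≤-refl)))
        (subst (D (suc e)) (solve 3 (λ s l v → s :- (l :+ v) :+ v := s :- l) refl _ _ _)
          (D-+ (S-small (m ℕ.+ m) (D-*-Z D-P Z-half) (ℕₚ.n<1+n _))
               -- As e is even, (p/2)ᵉ W is ½ᵉ times the quantity bounded in `D-W`.
               (subst (D (suc e)) (trans (solve 3 (λ h P W → h :* (P :* W) := P :* h :* W) refl (half ^ e) ((- P) ^ e) (W (m ℕ.+ m)))
                   (cong (_* W (m ℕ.+ m)) (trans (cong (_* half ^ e) (even P)) (sym (^-distrib-* P half e)))))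
                 (Z-*-D (Z-^ e Z-half) (D-W d))))))


    -- The binomial coefficient (2p choose p) modulo p² and p³

    q-1 : ∀ n → q 1# n ≡ 1#
    q-1 zero = refl
    q-1 (suc n) = trans (cong₂ (λ a b → a * b * rec (suc n)) (q-1 n) (sym (ι-suc n)))
      (trans (cong (_* rec (suc n)) (*-identityˡ _)) (rec-inverse n))

    -- The binomial coefficient (y-1 choose n), with its numerator read from the largest factor
    -- downwards.
    q-reversed : A → ℕ → A
    q-reversed y zero = 1#
    q-reversed y (suc n) = q-reversed y n * (y - ι (suc n)) * rec (suc n)

    q-reverse : ∀ x n → q-reversed (x + ι (suc n)) n ≡ q (x + 1#) n
    q-reverse x zero = refl
    q-reverse x (suc n) = begin
      q-reversed (x + ι (2 ℕ.+ n)) n * (x + ι (2 ℕ.+ n) - ι (suc n)) * z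
        ≡⟨ cong₂ (λ a b → a * b * z)
             (trans (cong (λ u → q-reversed u n) (trans (cong (x +_) (ι-suc (suc n))) (sym (+-assoc x 1# _)))) (q-reverse (x + 1#) n))
             (trans (cong (λ u → x + u - ι (suc n)) (ι-suc (suc n))) (solve 2 (λ x N → x :+ (# 1 :+ N) :- N := x :+ # 1) refl x (ι (suc n)))) ⟩
      q (x + 1# + 1#) n * (x + 1#) * z     ≡⟨ solve 3 (λ r x z → r :* x :* z := x :* z :* r) refl _ _ _ ⟩
      (x + 1#) * z * q (x + 1# + 1#) n     ≡⟨ q-suc (x + 1#) n ⟨
      q (x + 1#) (suc n) ∎
      where z = rec (suc n)

    recᶜ : ℕ → A
    recᶜ j = rec (p ℕ.∸ j)

    recᶜ-inverse : ∀ {j} → j ℕ.< p → (P - ι j) * recᶜ j ≡ 1#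
    recᶜ-inverse {j} j<p with ℕₚ.m≤n⇒∃[o]m+o≡n j<p
    ... | o , j+1+o≡p = trans (cong₂ (λ a b → a * rec b) P-j p∸j) (rec-inverse o)
      where
      p∸j : p ℕ.∸ j ≡ suc o
      p∸j = trans (cong (ℕ._∸ j) (trans (sym j+1+o≡p) (sym (ℕₚ.+-suc j o)))) (ℕₚ.m+n∸m≡n j (suc o))
      P-j : P - ι j ≡ ι (suc o)
      P-j = trans (cong (_- ι j) (trans (sym ι-p) (trans (cong ι (trans (sym j+1+o≡p) (sym (ℕₚ.+-suc j o)))) (ι-+ j (suc o)))))
              (solve 2 (λ j o → j :+ o :- j := o) refl (ι j) (ι (suc o)))

    Z-recᶜ : ∀ {j} → suc j ℕ.< p → Z (recᶜ (suc j))
    Z-recᶜ {j} j<p with p ℕ.∸ suc j in eq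
    ... | zero = ⊥-elim (ℕₚ.<⇒≱ j<p (ℕₚ.m∸n≡0⇒m≤n eq))
    ... | suc o = Z-rec< (subst (ℕ._< p) eq (ℕₚ.∸-monoʳ-< {p} (ℕ.s≤s ℕ.z≤n) (ℕₚ.<⇒≤ j<p)))

    v : ℕ → A
    v j = rec j * recᶜ j

    V : ℕ → A
    V zero = 1#
    V (suc n) = V n * (1# + ι 2 * (P * P) * v (suc n))

    Σv : ℕ → A
    Σv zero = 0#
    Σv (suc n) = Σv n + v (suc n)

    Z-v : ∀ {j} → suc j ℕ.< p → Z (v (suc j))
    Z-v j<p = Z-* (Z-rec< j<p) (Z-recᶜ j<p)

    Z-Σv : ∀ n → n ℕ.< p → Z (Σv n)
    Z-Σv zero _ = Z-0
    Z-Σv (suc n) n<p = Z-+ (Z-Σv n (ℕₚ.<⇒≤ n<p)) (Z-v n<p)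

    -- Pairing j with p - j: (p+j)(2p-j) = j(p-j) + 2p².
    q-pairing : ∀ n → n ℕ.< p → q (P + 1#) n * q-reversed (P + P) n ≡ q-reversed P n * V n
    q-pairing zero _ = refl
    q-pairing (suc n) n<p = begin
      a * (P + 1# + ι n) * z * (b * (P + P - J) * z)
        ≡⟨ cong (λ u → a * u * z * (b * (P + P - J) * z)) (trans (+-assoc P 1# (ι n)) (cong (P +_) (sym (ι-suc n)))) ⟩
      a * (P + J) * z * (b * (P + P - J) * z)
        ≡⟨ solve 5 (λ a P J z b →
              a :* (P :+ J) :* z :* (b :* (P :+ P :- J) :* z)
              := a :* b :* ((P :- J) :* z :* (J :* z) :+ # 2 :* (P :* P) :* (z :* z) :* # 1)) refl a P J z b ⟩
      a * b * ((P - J) * z * (J * z) + ι 2 * (P * P) * (z * z) * 1#)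
        ≡⟨ cong₂ (λ s t → a * b * ((P - J) * z * s + ι 2 * (P * P) * (z * z) * t)) (rec-inverse n) (sym (recᶜ-inverse n<p)) ⟩
      a * b * ((P - J) * z * 1# + ι 2 * (P * P) * (z * z) * ((P - J) * u))
        ≡⟨ cong (_* ((P - J) * z * 1# + ι 2 * (P * P) * (z * z) * ((P - J) * u))) (q-pairing n (ℕₚ.<⇒≤ n<p)) ⟩
      c * V n * ((P - J) * z * 1# + ι 2 * (P * P) * (z * z) * ((P - J) * u))
        ≡⟨ solve 6 (λ c V x z P u →
              c :* V :* (x :* z :* # 1 :+ # 2 :* (P :* P) :* (z :* z) :* (x :* u))
              := c :* x :* z :* (V :* (# 1 :+ # 2 :* (P :* P) :* (z :* u)))) refl c (V n) (P - J) z P u ⟩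
      c * (P - J) * z * V (suc n) ∎
      where
      a = q (P + 1#) n
      b = q-reversed (P + P) n
      c = q-reversed P n
      J = ι (suc n)
      z = rec (suc n)
      u = recᶜ (suc n)

    -- This is (2p-1 choose p-1), half of (2p choose p).
    central : A
    central = q (P + 1#) (m ℕ.+ m)

    -- One copy is read upwards and one downwards, so that p+j meets 2p-j. The other side of the
    -- pairing is (p-1 choose p-1) = 1 times `V`.
    central² : central * central ≡ V (m ℕ.+ m)
    central² = begin
      central * central                              ≡⟨ cong (central *_) (q-reverse P (m ℕ.+ m)) ⟨
      central * q-reversed (P + ι p) (m ℕ.+ m)       ≡⟨ cong (λ u → central * q-reversed (P + u) (m ℕ.+ m)) ι-p ⟩
      central * q-reversed (P + P) (m ℕ.+ m)         ≡⟨ q-pairing (m ℕ.+ m) (ℕₚ.n<1+n _) ⟩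
      q-reversed P (m ℕ.+ m) * V (m ℕ.+ m)           ≡⟨ cong (_* V (m ℕ.+ m)) q-reversed-P ⟩
      1# * V (m ℕ.+ m)                               ≡⟨ *-identityˡ _ ⟩
      V (m ℕ.+ m) ∎
      where
      q-reversed-P : q-reversed P (m ℕ.+ m) ≡ 1#
      q-reversed-P = trans (cong (λ u → q-reversed u (m ℕ.+ m)) (trans (sym ι-p) (sym (+-identityˡ _))))
        (trans (q-reverse 0# (m ℕ.+ m)) (trans (cong (λ u → q u (m ℕ.+ m)) (+-identityˡ 1#)) (q-1 (m ℕ.+ m))))

    D-V : ∀ n → n ℕ.< p → D 3 (V n - (1# + P * P * (ι 2 * Σv n)))
    D-V zero _ = subst (D 3) (solve 1 (λ P → # 0 := # 1 :- (# 1 :+ P :* P :* (# 2 :* # 0))) refl P) D-0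
    D-V (suc n) n<p = subst (D 3)
      (solve 4 (λ V P s v →
              (V :- (# 1 :+ P :* P :* (# 2 :* s))) :* (# 1 :+ # 2 :* (P :* P) :* v) :+ P :* (P :* P) :* (P :* (# 4 :* s :* v))
              := V :* (# 1 :+ # 2 :* (P :* P) :* v) :- (# 1 :+ P :* P :* (# 2 :* (s :+ v)))) refl (V n) P (Σv n) (v (suc n)))
      (D-+ (D-*-Z (D-V n (ℕₚ.<⇒≤ n<p)) (Z-+ Z-1 (Z-* (Z-* (Z-ι 2) (Z-* Z-P Z-P)) (Z-v n<p))))
           (D-*-Z (D-* D-P (D-* D-P D-P)) (Z-* Z-P (Z-* (Z-* (Z-ι 4) (Z-Σv n (ℕₚ.<⇒≤ n<p))) (Z-v n<p)))))

    D-central₁ : ∀ n → n ℕ.< p → D 1 (q (P + 1#) n - 1#)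
    D-central₁ zero _ = subst (D 1) (sym (-‿inverseʳ 1#)) D-0
    D-central₁ (suc n) n<p = subst (D 1) eq
      (D-+ (D-central₁ n (ℕₚ.<⇒≤ n<p)) (D-*-Z D-P (Z-* (Z-q (Z-+ Z-P Z-1) (ℕₚ.<⇒≤ n<p)) (Z-rec< n<p))))
      where
      eq : q (P + 1#) n - 1# + P * (q (P + 1#) n * rec (suc n)) ≡ q (P + 1#) n * (P + 1# + ι n) * rec (suc n) - 1#
      eq = trans (solve 3 (λ a P z → a :- # 1 :+ P :* (a :* z) := a :* (P :* z) :+ a :* # 1 :- # 1) refl (q (P + 1#) n) P (rec (suc n)))
        (trans (cong (λ u → q (P + 1#) n * (P * rec (suc n)) + q (P + 1#) n * u - 1#)
                 (trans (sym (rec-inverse n)) (cong (_* rec (suc n)) (ι-suc n))))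
               (solve 4 (λ a P z N →
              a :* (P :* z) :+ a :* ((# 1 :+ N) :* z) :- # 1
              := a :* (P :+ # 1 :+ N) :* z :- # 1) refl (q (P + 1#) n) P (rec (suc n)) (ι n)))

    D-halve : ∀ {k x} → D k (ι 2 * x) → D k x
    D-halve {x = x} d = subst (D _) (trans (solve 2 (λ h x → h :* (# 2 :* x) := # 2 :* h :* x) refl half x)
      (trans (cong (_* x) 2half) (*-identityˡ x))) (Z-*-D Z-half d)

    -- Since b²-1 = 2(b-1) + (b-1)², a first approximation b ≡ 1 makes the square negligible.
    -- `D-central₁` selects the root, and each application then raises the exponent by one.
    D-square-root : ∀ {k b} → D k (b * b - 1#) → D k ((b - 1#) * (b - 1#)) → D k (b - 1#)
    D-square-root {b = b} d d' = D-halve (subst (D _) (solve 1 (λ b → b :* b :- # 1 :- (b :- # 1) :* (b :- # 1) := # 2 :* (b :- # 1)) refl b) (D-- d d'))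

    D-central₂ : D 2 (central - 1#)
    D-central₂ = D-square-root
      (subst (D 2) (trans (solve 2 (λ V x → V :- (# 1 :+ x) :+ x := V :- # 1) refl (V (m ℕ.+ m)) _) (cong (_- 1#) (sym central²)))
        (D-+ (D-weaken (ℕ.s≤s (ℕ.s≤s ℕ.z≤n)) (D-V (m ℕ.+ m) (ℕₚ.n<1+n _)))
             (D-*-Z (D-* D-P D-P) (Z-* (Z-ι 2) (Z-Σv (m ℕ.+ m) (ℕₚ.n<1+n _))))))
      (D-* d d)
      where d = D-central₁ (m ℕ.+ m) (ℕₚ.n<1+n _)

    D-central₃ : D 1 (Σv (m ℕ.+ m)) → D 3 (central - 1#)
    D-central₃ dΣ = D-square-root
      (subst (D 3) (trans (solve 2 (λ V x → V :- (# 1 :+ x) :+ x := V :- # 1) refl (V (m ℕ.+ m)) _) (cong (_- 1#) (sym central²)))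
        (D-+ (D-V (m ℕ.+ m) (ℕₚ.n<1+n _)) (D-* (D-* D-P D-P) (Z-*-D (Z-ι 2) dΣ))))
      (D-weaken (ℕ.s≤s (ℕ.s≤s (ℕ.s≤s ℕ.z≤n))) (D-* D-central₂ D-central₂))

    H : ℕ → A
    H zero = 0#
    H (suc n) = H n + rec (suc n) * rec (suc n)

    -- Halving modulo p permutes the residues 1, …, p-1, so 4 Σ 1/j² ≡ Σ 1/j².
    D-H-halving : ∀ n → n ℕ.≤ m → D 1 (ι 4 * H (n ℕ.+ n) - (H n + (H (m ℕ.+ n) - H m)))
    D-H-halving zero _ = subst (D 1)
      (sym (trans (cong (λ u → ι 4 * 0# - (0# + (H u - H m))) (ℕₚ.+-identityʳ m))
        (solve 1 (λ h → # 4 :* # 0 :- (# 0 :+ (h :- h)) := # 0) refl (H m)))) D-0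
    D-H-halving (suc n) n<m rewrite ℕₚ.+-suc n n | ℕₚ.+-suc m n = subst (D 1) rearrange
      (D-+ (D-H-halving n (ℕₚ.<⇒≤ n<m)) (D-*-Z D-P (Z-* (Z-* zx zy) (Z-+ (Z-* (Z-ι 2) zy) zx))))
      where
      -- The even index 2n+2 contributes 4t² = z² exactly. The odd index satisfies 2n+1 = 2(m+n+1) -
      -- p, so 4y² ≡ x² modulo p.
      x = rec (suc (m ℕ.+ n))
      y = rec (suc (n ℕ.+ n))
      z = rec (suc n)
      t = rec (2 ℕ.+ (n ℕ.+ n))
      zx : Z x
      zx = Z-rec< (ℕ.s≤s (subst (ℕ._≤ m ℕ.+ m) (ℕₚ.+-suc m n) (ℕₚ.+-monoʳ-≤ m n<m)))
      zy : Z y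
      zy = Z-rec< (ℕ.s≤s (ℕₚ.≤-trans (ℕₚ.+-monoˡ-≤ n n<m) (ℕₚ.+-monoʳ-≤ m (ℕₚ.<⇒≤ n<m))))
      2t≡z : ι 2 * t ≡ z
      2t≡z = inverse-unique {ι (suc n)} (trans (solve 2 (λ N t → N :* (# 2 :* t) := (N :+ N) :* t) refl (ι (suc n)) t)
        (trans (cong (_* t) (trans (sym (ι-+ (suc n) (suc n))) (cong (λ k → ι (suc k)) (ℕₚ.+-suc n n)))) (rec-inverse (suc (n ℕ.+ n))))) (rec-inverse n)
      Pxy : P * (x * y) ≡ ι 2 * y - x
      Pxy = begin
        P * (x * y)
          ≡⟨ solve 4 (λ M N x y →
              (# 1 :+ # 2 :* M) :* (x :* y)
              := # 2 :* y :* ((# 1 :+ (M :+ N)) :* x) :- x :* ((# 1 :+ (N :+ N)) :* y)) refl (ι m) (ι n) x y ⟩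
        ι 2 * y * ((1# + (ι m + ι n)) * x) - x * ((1# + (ι n + ι n)) * y)
          ≡⟨ cong₂ (λ a b → ι 2 * y * (a * x) - x * (b * y)) (sym (ι-suc-+ m n)) (sym (ι-suc-+ n n)) ⟩
        ι 2 * y * (ι (suc (m ℕ.+ n)) * x) - x * (ι (suc (n ℕ.+ n)) * y)
          ≡⟨ cong₂ (λ a b → ι 2 * y * a - x * b) (rec-inverse (m ℕ.+ n)) (rec-inverse (n ℕ.+ n)) ⟩
        ι 2 * y * 1# - x * 1#
          ≡⟨ cong₂ _-_ (*-identityʳ _) (*-identityʳ _) ⟩
        ι 2 * y - x ∎
        where
        ι-suc-+ : ∀ a b → ι (suc (a ℕ.+ b)) ≡ 1# + (ι a + ι b)
        ι-suc-+ a b = trans (ι-suc (a ℕ.+ b)) (cong (1# +_) (ι-+ a b))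
      rearrange : ι 4 * H (n ℕ.+ n) - (H n + (H (m ℕ.+ n) - H m)) + P * (x * y * (ι 2 * y + x))
        ≡ ι 4 * (H (n ℕ.+ n) + y * y + t * t) - (H n + z * z + (H (m ℕ.+ n) + x * x - H m))
      rearrange = begin
        ι 4 * h₁ - (h₂ + (h₃ - h₄)) + P * (x * y * (ι 2 * y + x))
          ≡⟨ cong (ι 4 * h₁ - (h₂ + (h₃ - h₄)) +_) (trans (sym (*-assoc P (x * y) _)) (cong (_* (ι 2 * y + x)) Pxy)) ⟩
        ι 4 * h₁ - (h₂ + (h₃ - h₄)) + (ι 2 * y - x) * (ι 2 * y + x)
          ≡⟨ solve 7 (λ a b c d x y t →
              # 4 :* a :- (b :+ (c :- d)) :+ (# 2 :* y :- x) :* (# 2 :* y :+ x)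
              := # 4 :* (a :+ y :* y :+ t :* t) :- (b :+ # 2 :* t :* (# 2 :* t) :+ (c :+ x :* x :- d))) refl h₁ h₂ h₃ h₄ x y t ⟩
        ι 4 * (h₁ + y * y + t * t) - (h₂ + ι 2 * t * (ι 2 * t) + (h₃ + x * x - h₄))
          ≡⟨ cong (λ u → ι 4 * (h₁ + y * y + t * t) - (h₂ + u * u + (h₃ + x * x - h₄))) 2t≡z ⟩
        ι 4 * (h₁ + y * y + t * t) - (h₂ + z * z + (h₃ + x * x - h₄)) ∎
        where
        h₁ = H (n ℕ.+ n)
        h₂ = H n
        h₃ = H (m ℕ.+ n)
        h₄ = H m

    -- The halving argument gives 3H ≡ 0, and p > 3 makes 3 invertible.
    D-H : 3 ℕ.< p → D 1 (H (m ℕ.+ m))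
    D-H 3<p = subst (D 1) (trans (cong (_* H (m ℕ.+ m)) (trans (*-comm (rec 3) (ι 3)) (rec-inverse 2))) (*-identityˡ _))
      (subst (D 1) (solve 3 (λ r a b → r :* (# 4 :* a :- (b :+ (a :- b))) := r :* # 3 :* a) refl (rec 3) (H (m ℕ.+ m)) (H m))
        (Z-*-D (Z-rec< 3<p) (D-H-halving m ℕₚ.≤-refl)))

    -- Modulo p, 1/(j(p-j)) ≡ -1/j².
    D-Σv+H : ∀ n → n ℕ.< p → D 1 (Σv n + H n)
    D-Σv+H zero _ = subst (D 1) (sym (+-identityˡ 0#)) D-0
    D-Σv+H (suc n) n<p = subst (D 1) eq
      (D-+ (D-Σv+H n (ℕₚ.<⇒≤ n<p)) (D-*-Z D-P (Z-* (Z-* (Z-rec< n<p) (Z-rec< n<p)) (Z-recᶜ n<p))))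
      where
      z = rec (suc n)
      u = recᶜ (suc n)
      J = ι (suc n)
      eq : Σv n + H n + P * (z * z * u) ≡ Σv n + z * u + (H n + z * z)
      eq = trans (solve 6 (λ s h P z u J →
              s :+ h :+ P :* (z :* z :* u)
              := s :+ z :* u :* (J :* z) :+ (h :+ z :* z :* ((P :- J) :* u))) refl (Σv n) (H n) P z u J)
        (trans (cong₂ (λ a b → Σv n + z * u * a + (H n + z * z * b)) (rec-inverse n) (recᶜ-inverse n<p))
          (solve 4 (λ s h z u → s :+ z :* u :* # 1 :+ (h :+ z :* z :* # 1) := s :+ z :* u :+ (h :+ z :* z)) refl (Σv n) (H n) z u))

    D-Σv : 3 ℕ.< p → D 1 (Σv (m ℕ.+ m))
    D-Σv 3<p = subst (D 1) (solve 2 (λ a b → a :+ b :- b := a) refl _ _) (D-- (D-Σv+H (m ℕ.+ m) (ℕₚ.n<1+n _)) (D-H 3<p))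

    weight-p : weight 1# p - ι 2 ≡ ι 2 * (central - 1#)
    weight-p = trans (cong (_- ι 2) (trans (weight-suc≡2q (m ℕ.+ m)) (cong (λ u → ι 2 * q (u + 1#) (m ℕ.+ m)) ι-p)))
      (solve 1 (λ c → # 2 :* c :- # 2 := # 2 :* (c :- # 1)) refl central)

    babbage : D 2 (weight 1# p - ι 2)
    babbage = subst (D 2) (sym weight-p) (Z-*-D (Z-ι 2) D-central₂)

    wolstenholme : 3 ℕ.< p → D 3 (weight 1# p - ι 2)
    wolstenholme 3<p = subst (D 3) (sym weight-p) (Z-*-D (Z-ι 2) (D-central₃ (D-Σv 3<p)))

    -- The first two sums

    module Sum₁ where

      -- The factor 3n+1 made homogeneous by reading 1 as 2τ; at n = 0 and τ = p/2 it is p.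
      L : A → A → A
      L x τ = ι 3 * x + ι 2 * τ

      certificate : ∀ N τ →
        (τ + (1# + N)) ^ 2 * L (1# + N) (τ + 1#) + 1# * ((1# + N) ^ 2 * (1# + N)) * 1#
        ≡ τ ^ 2 * L (1# + N) τ + (ι 4 * (1# + N) + ι 2) * 1# * (τ + (1# + N)) ^ 2
      certificate = solve 2 (λ N τ →
              # 1 :* (τ :+ (# 1 :+ N)) :* (τ :+ (# 1 :+ N)) :* (# 3 :* (# 1 :+ N) :+ # 2 :* (τ :+ # 1)) :+ # 1 :* (# 1 :* (# 1 :+ N) :* (# 1 :+ N) :* (# 1 :+ N)) :* # 1
              := # 1 :* τ :* τ :* (# 3 :* (# 1 :+ N) :+ # 2 :* τ) :+ (# 4 :* (# 1 :+ N) :+ # 2) :* # 1 :* (# 1 :* (τ :+ (# 1 :+ N)) :* (τ :+ (# 1 :+ N)))) refl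

      certificate₀ : ∀ τ → L 0# (τ + 1#) ≡ L 0# τ + ι 2 * 1#
      certificate₀ = solve 1 (λ τ → # 3 :* # 0 :+ # 2 :* (τ :+ # 1) := # 3 :* # 0 :+ # 2 :* τ :+ # 2 :* # 1) refl

      open WZ 1# (*-identityˡ 1#) 2 L (λ _ _ → 1#) certificate₀ certificate public using (F)

      congruence : D 3 (sum m (F half) - P)
      congruence = subst (D 3) (cong (λ u → sum m (F half) - u) L₀)
        -- With w = (2p choose p), the terms n = 0 and n = p at τ = -p add up to p(w-2), so w ≡ 2
        -- modulo p² is enough.
        (supercongruence (subst (D 3) (solve 2 (λ P w → P :* (w :- # 2) := # 3 :* # 0 :+ # 2 :* :- P :+ w :* (# 3 :* P :+ # 2 :* :- P)) refl P (weight 1# p))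
          (D-* D-P babbage)))
        where
        open WZ-Local 1# (*-identityˡ 1#) Z-1 2 (solve 0 (# 1 :* # 0 :* # 0 := # 0) refl)
          (solve 1 (λ x → # 1 :* :- x :* :- x := # 1 :* x :* x) refl) L (λ _ _ → 1#) certificate₀ certificate
          (solve 0 (# 3 :* # 0 :+ # 2 :* # 0 := # 0) refl)
          (λ zx zτ → Z-+ (Z-* (Z-ι 3) zx) (Z-* (Z-ι 2) zτ)) (λ _ _ → Z-1)
          (λ {x} {τ} _ dτ → subst (D 1) (solve 2 (λ x τ → # 2 :* τ := # 3 :* x :+ # 2 :* τ :- (# 3 :* x :+ # 2 :* # 0)) refl x τ) (Z-*-D (Z-ι 2) dτ))
        L₀ : L 0# (P * half) ≡ P
        L₀ = trans (solve 2 (λ P h → # 3 :* # 0 :+ # 2 :* (P :* h) := P :* (# 2 :* h)) refl P half) (trans (cong (P *_) 2half) (*-identityʳ P))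

    module Sum₂ where

      -- Again 10n²+6n+1 with 1 read as 2τ: the constant becomes 4τ², and at n = 0 and τ = p/2 the
      -- value is p².
      L g : A → A → A
      L x τ = ι 10 * (x * x) + ι 12 * τ * x + ι 4 * (τ * τ)
      g x τ = ι 2 * x + ι 2 + ι 4 * τ

      certificate : ∀ N τ →
        (τ + (1# + N)) ^ 4 * L (1# + N) (τ + 1#) + - 1# * ((1# + N) ^ 4 * (1# + N)) * g N τ
        ≡ τ ^ 4 * L (1# + N) τ + (ι 4 * (1# + N) + ι 2) * g (1# + N) τ * (τ + (1# + N)) ^ 4
      certificate = solve 2 (λ N τ →
              # 1 :* (τ :+ (# 1 :+ N)) :* (τ :+ (# 1 :+ N)) :* (τ :+ (# 1 :+ N)) :* (τ :+ (# 1 :+ N))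
                :* (# 10 :* ((# 1 :+ N) :* (# 1 :+ N)) :+ # 12 :* (τ :+ # 1) :* (# 1 :+ N) :+ # 4 :* ((τ :+ # 1) :* (τ :+ # 1)))
                :+ :- # 1 :* (# 1 :* (# 1 :+ N) :* (# 1 :+ N) :* (# 1 :+ N) :* (# 1 :+ N) :* (# 1 :+ N)) :* (# 2 :* N :+ # 2 :+ # 4 :* τ)
              := # 1 :* τ :* τ :* τ :* τ :* (# 10 :* ((# 1 :+ N) :* (# 1 :+ N)) :+ # 12 :* τ :* (# 1 :+ N) :+ # 4 :* (τ :* τ))
                :+ (# 4 :* (# 1 :+ N) :+ # 2) :* (# 2 :* (# 1 :+ N) :+ # 2 :+ # 4 :* τ)
                :* (# 1 :* (τ :+ (# 1 :+ N)) :* (τ :+ (# 1 :+ N)) :* (τ :+ (# 1 :+ N)) :* (τ :+ (# 1 :+ N)))) refl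

      certificate₀ : ∀ τ → L 0# (τ + 1#) ≡ L 0# τ + ι 2 * g 0# τ
      certificate₀ = solve 1 (λ τ →
              # 10 :* (# 0 :* # 0) :+ # 12 :* (τ :+ # 1) :* # 0 :+ # 4 :* ((τ :+ # 1) :* (τ :+ # 1))
              := # 10 :* (# 0 :* # 0) :+ # 12 :* τ :* # 0 :+ # 4 :* (τ :* τ) :+ # 2 :* (# 2 :* # 0 :+ # 2 :+ # 4 :* τ)) refl

      ε² : - 1# * - 1# ≡ 1#
      ε² = solve 0 (:- # 1 :* :- # 1 := # 1) refl

      open WZ (- 1#) ε² 4 L g certificate₀ certificate public using (F)

      congruence : 3 ℕ.< p → D 5 (sum m (F half) - P * P)
      congruence 3<p = subst (D 5) (cong (λ u → sum m (F half) - u) L₀)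
        -- Here L(0,-p) = 4p², L(p,-p) = 2p² and the weight is -w, so the two end terms give
        -- -2p²(w-2); reaching p⁵ takes w ≡ 2 modulo p³.
        (supercongruence (subst (D 5) hypothesis (D-* (D-* D-P D-P) (D-neg (Z-*-D (Z-ι 2) (wolstenholme 3<p))))))
        where
        open WZ-Local (- 1#) ε² (Z-neg Z-1) 4 (solve 0 (# 1 :* # 0 :* # 0 :* # 0 :* # 0 := # 0) refl)
          (solve 1 (λ x → # 1 :* :- x :* :- x :* :- x :* :- x := # 1 :* x :* x :* x :* x) refl) L g certificate₀ certificate
          (solve 0 (# 10 :* (# 0 :* # 0) :+ # 12 :* # 0 :* # 0 :+ # 4 :* (# 0 :* # 0) := # 0) refl)
          (λ zx zτ → Z-+ (Z-+ (Z-* (Z-ι 10) (Z-* zx zx)) (Z-* (Z-* (Z-ι 12) zτ) zx)) (Z-* (Z-ι 4) (Z-* zτ zτ)))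
          (λ zx zτ → Z-+ (Z-+ (Z-* (Z-ι 2) zx) (Z-ι 2)) (Z-* (Z-ι 4) zτ))
          (λ {x} {τ} zx dτ → subst (D 1)
            (solve 2 (λ x τ →
              τ :* (# 12 :* x :+ # 4 :* τ)
              := # 10 :* (x :* x) :+ # 12 :* τ :* x :+ # 4 :* (τ :* τ) :- (# 10 :* (x :* x) :+ # 12 :* # 0 :* x :+ # 4 :* (# 0 :* # 0))) refl x τ)
            (D-*-Z dτ (Z-+ (Z-* (Z-ι 12) zx) (Z-* (Z-ι 4) (D⇒Z dτ)))))
        L₀ : L 0# (P * half) ≡ P * P
        L₀ = trans (solve 2 (λ P h →
              # 10 :* (# 0 :* # 0) :+ # 12 :* (P :* h) :* # 0 :+ # 4 :* (P :* h :* (P :* h))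
              := P :* P :* (# 2 :* h :* (# 2 :* h))) refl P half)
          (trans (cong (λ u → P * P * (u * u)) 2half) (solve 1 (λ x → x :* (# 1 :* # 1) := x) refl (P * P)))
        sign : ∀ n → (- 1#) ^ (n ℕ.+ n) ≡ 1#
        sign zero = refl
        sign (suc n) = trans (cong (λ k → (- 1#) ^ suc k) (ℕₚ.+-suc n n))
          (trans (solve 1 (λ s → s :* :- # 1 :* :- # 1 := s) refl ((- 1#) ^ (n ℕ.+ n))) (sign n))
        hypothesis : P * P * - (ι 2 * (weight 1# p - ι 2)) ≡ L 0# (- P) + weight (- 1#) p * L P (- P)
        hypothesis = trans
          (solve 2 (λ P w →
              P :* P :* :- (# 2 :* (w :- # 2))
              := # 10 :* (# 0 :* # 0) :+ # 12 :* :- P :* # 0 :+ # 4 :* (:- P :* :- P)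
                :+ # 1 :* :- # 1 :* w :* (# 10 :* (P :* P) :+ # 12 :* :- P :* P :+ # 4 :* (:- P :* :- P))) refl P (weight 1# p))
          (cong (λ u → L 0# (- P) + u * L P (- P)) (sym (trans (weight-sign (- 1#) p)
            (cong (λ u → u * - 1# * weight 1# p) (sign m)))))


    -- Second-order expansions in p and the perturbed summand

    -- Jet x f g: x ≡ 1 + f p + g p² modulo p³.
    record Jet (x f g : A) : Set where
      constructor jet
      field
        Z-f : Z f
        Z-g : Z g
        remainder : D 3 (x - (1# + f * P + g * (P * P)))

    Z-quadratic : ∀ {f g} → Z f → Z g → Z (1# + f * P + g * (P * P))
    Z-quadratic zf zg = Z-+ (Z-+ Z-1 (Z-* zf Z-P)) (Z-* zg (Z-* Z-P Z-P))

    D-P³ : D 3 (P * (P * P))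
    D-P³ = D-* D-P (D-* D-P D-P)

    Jet⇒Z : ∀ {x f g} → Jet x f g → Z x
    Jet⇒Z {x} (jet zf zg d) = subst Z (solve 2 (λ x y → x :- y :+ y := x) refl x _) (Z-+ (D⇒Z d) (Z-quadratic zf zg))

    Jet-1 : Jet 1# 0# 0#
    Jet-1 = jet Z-0 Z-0 (subst (D 3) (solve 1 (λ P → # 0 := # 1 :- (# 1 :+ # 0 :* P :+ # 0 :* (P :* P))) refl P) D-0)

    Jet-linear : ∀ {f} → Z f → Jet (1# + f * P) f 0#
    Jet-linear {f} zf = jet zf Z-0 (subst (D 3) (solve 2 (λ f P → # 0 := # 1 :+ f :* P :- (# 1 :+ f :* P :+ # 0 :* (P :* P))) refl f P) D-0)

    Jet-* : ∀ {x f g x' f' g'} → Jet x f g → Jet x' f' g' → Jet (x * x') (f + f') (g + g' + f * f')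
    Jet-* {x} {f} {g} {x'} {f'} {g'} j@(jet zf zg d) j'@(jet zf' zg' d') =
      jet (Z-+ zf zf') (Z-+ (Z-+ zg zg') (Z-* zf zf'))
        (subst (D 3)
          (solve 7 (λ x f g x' f' g' P →
              x :* x' :- (# 1 :+ f :* P :+ g :* (P :* P)) :* (# 1 :+ f' :* P :+ g' :* (P :* P)) :+ P :* (P :* P) :* (f :* g' :+ f' :* g :+ P :* (g :* g'))
              := x :* x' :- (# 1 :+ (f :+ f') :* P :+ (g :+ g' :+ f :* f') :* (P :* P))) refl x f g x' f' g' P)
          (D-+ (D-*-cong (Z-quadratic zf zg) (Jet⇒Z j') d d')
               (D-*-Z D-P³ (Z-+ (Z-+ (Z-* zf zg') (Z-* zf' zg)) (Z-* Z-P (Z-* zg zg'))))))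

    Jet-inverse : ∀ {x f k} → Z k → x * k ≡ 1# → Jet x f 0# → Jet k (- f) (f * f)
    Jet-inverse {x} {f} {k} zk xk≡1 (jet zf _ d) = jet (Z-neg zf) (Z-* zf zf)
      (subst (D 3)
        (trans (solve 4 (λ x f k P →
              k :* (:- ((x :- (# 1 :+ f :* P :+ # 0 :* (P :* P))) :* (# 1 :+ :- f :* P :+ f :* f :* (P :* P))) :+ P :* (P :* P) :* :- (f :* f :* f))
              := k :- x :* k :* (# 1 :+ :- f :* P :+ f :* f :* (P :* P))) refl x f k P)
          (trans (cong (λ u → k - u * (1# + - f * P + f * f * (P * P))) xk≡1) (cong (λ u → k - u) (*-identityˡ _))))
        (Z-*-D zk (D-+ (D-neg (D-*-Z d (Z-quadratic (Z-neg zf) (Z-* zf zf)))) (D-*-Z D-P³ (Z-neg (Z-* (Z-* zf zf) zf))))))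

    -- The perturbed denominators 1+ap+n with n < m must be units at p. The inverses are carried as
    -- data because each a expresses them through a different integer reciprocal.
    record Inverses (a : A) : Set where
      field
        Z-a : Z a
        inv : ℕ → A
        Z-inv : ∀ n → n ℕ.< m → Z (inv n)
        inv-inverse : ∀ n → n ℕ.< m → (1# + a * P + ι n) * inv n ≡ 1#

    odd z : ℕ → A
    odd n = rec (suc (n ℕ.+ n))
    z n = rec (suc n)

    odd-inverse : ∀ n → (1# + ι 2 * ι n) * odd n ≡ 1#
    odd-inverse n = trans (cong (_* odd n) (sym (trans (ι-suc (n ℕ.+ n)) (cong (1# +_) (trans (ι-+ n n) (solve 1 (λ N → N :+ N := # 2 :* N) refl (ι n)))))))
      (rec-inverse (n ℕ.+ n))

    z-inverse : ∀ n → (1# + ι n) * z n ≡ 1#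
    z-inverse n = trans (cong (_* z n) (sym (ι-suc n))) (rec-inverse n)

    suc<p : ∀ {n} → n ℕ.< m → suc n ℕ.< p
    suc<p n<m = ℕₚ.≤-<-trans n<m m<p

    Z-z : ∀ {n} → n ℕ.< m → Z (z n)
    Z-z n<m = Z-rec< (suc<p n<m)

    Z-odd : ∀ {n} → n ℕ.< m → Z (odd n)
    Z-odd n<m = Z-rec< (ℕ.s≤s (ℕₚ.+-mono-<-≤ n<m (ℕₚ.<⇒≤ n<m)))

    -- Partial sums of the p and p² coefficients of the quotient of consecutive ratios. That
    -- quotient is symmetric in a and b, so its coefficients are polynomials in a+b and ab; `χ` also
    -- collects the products of earlier and new linear terms.
    φ ψ χ : ℕ → A
    φ zero = 0#
    φ (suc n) = φ n + (ι 2 * odd n - z n)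
    ψ zero = 0#
    ψ (suc n) = ψ n + (odd n * odd n - z n * z n)
    χ zero = 0#
    χ (suc n) = χ n + ((odd n - z n) * (odd n - z n) + φ n * (ι 2 * odd n - z n))

    Z-ψ : ∀ n → n ℕ.≤ m → Z (ψ n)
    Z-ψ zero _ = Z-0
    Z-ψ (suc n) n<m = Z-+ (Z-ψ n (ℕₚ.<⇒≤ n<m)) (Z-- (Z-* (Z-odd n<m) (Z-odd n<m)) (Z-* (Z-z n<m) (Z-z n<m)))

    t : ℕ → A
    t = T 0# 0# (λ n → z n * z n * z n)

    Z-t : ∀ n → n ℕ.≤ m → Z (t n)
    Z-t n n≤m = Z-* (Z-prod n n≤m) (Z-numer n)
      where
      Z-prod : ∀ n → n ℕ.≤ m → Z (prod (λ n → z n * z n * z n) n)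
      Z-prod zero _ = Z-1
      Z-prod (suc n) n<m = Z-* (Z-prod n (ℕₚ.<⇒≤ n<m)) (Z-* (Z-* (Z-z n<m) (Z-z n<m)) (Z-z n<m))
      Z-numer : ∀ n → Z (numer 0# 0# n)
      Z-numer zero = Z-1
      Z-numer (suc n) = Z-neg (Z-* (Z-numer n) (Z-* (Z-* (Z-+ (Z-+ Z-1 Z-0) z2n) (Z-+ (Z-+ Z-1 Z-0) z2n)) (Z-+ (Z-+ (Z-+ Z-1 Z-0) Z-0) z2n)))
        where z2n = Z-* (Z-ι 2) (Z-ι n)

    -- Modulo p³ the perturbed summand depends on (a,b) only through a+b and ab.
    module Perturbation {a b : A} (A⁻ : Inverses a) (B⁻ : Inverses b) where
      open Inverses A⁻ renaming (Z-a to Z-a₀; inv to invᵃ; Z-inv to Z-invᵃ; inv-inverse to invᵃ-inverse)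
      open Inverses B⁻ renaming (Z-a to Z-b₀; inv to invᵇ; Z-inv to Z-invᵇ; inv-inverse to invᵇ-inverse)

      κ : ℕ → A
      κ n = z n * invᵃ n * invᵇ n

      δκ≡1 : ∀ n → n ℕ.< m → δ (a * P) (b * P) n * κ n ≡ 1#
      δκ≡1 n n<m = trans (solve 6 (λ x y w z s t → x :* y :* w :* (z :* s :* t) := x :* z :* (y :* s) :* (w :* t)) refl _ _ _ _ _ _)
        (trans (cong₂ _*_ (cong₂ _*_ (z-inverse n) (invᵃ-inverse n n<m)) (invᵇ-inverse n n<m)) (solve 0 (# 1 :* # 1 :* # 1 := # 1) refl))

      ratio : ℕ → A
      ratio n = (1# + a * odd n * P) * (1# + b * odd n * P) * (1# + (a + b) * odd n * P)
              * (((1# + ι n) * invᵃ n) * ((1# + ι n) * invᵇ n))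

      R : ℕ → A
      R = prod ratio

      T≡t*R : ∀ n → T (a * P) (b * P) κ n ≡ t n * R n
      T≡t*R zero = solve 0 (# 1 :* # 1 := # 1 :* # 1 :* # 1) refl
      T≡t*R (suc n) = begin
        k * (zₙ * i * j) * - (M * ((1# + a * P + o) * (1# + b * P + o) * (1# + a * P + b * P + o)))
          ≡⟨ solve 9 (λ k z i j M a b P o →
              k :* (z :* i :* j) :* :- (M :* ((# 1 :+ a :* P :+ o) :* (# 1 :+ b :* P :+ o) :* (# 1 :+ a :* P :+ b :* P :+ o)))
              := k :* M :* :- (z :* (# 1 :* i) :* (# 1 :* j) :* ((# 1 :+ o :+ a :* P :* # 1) :* (# 1 :+ o :+ b :* P :* # 1) :* (# 1 :+ o :+ (a :+ b) :* P :* # 1)))) refl k zₙ i j M a b P o ⟩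
        k * M * - (zₙ * (1# * i) * (1# * j) * ((1# + o + a * P * 1#) * (1# + o + b * P * 1#) * (1# + o + (a + b) * P * 1#)))
          -- Writing 1 as (1+n)z and as (1+2n)y pulls the unperturbed factors out and leaves
          -- `ratio n`.
          ≡⟨ cong₂ (λ u v → k * M * - (zₙ * (u * i) * (u * j) * ((1# + o + a * P * v) * (1# + o + b * P * v) * (1# + o + (a + b) * P * v))))
               (sym (z-inverse n)) (sym (odd-inverse n)) ⟩
        k * M * factor
          ≡⟨ cong (_* factor) (T≡t*R n) ⟩
        k₀ * M₀ * r * factor
          ≡⟨ solve 12 (λ k M r z N i j o a b P y →
              k :* M :* r :* :- (z :* ((# 1 :+ N) :* z :* i) :* ((# 1 :+ N) :* z :* j) :* ((# 1 :+ o :+ a :* P :* ((# 1 :+ o) :* y)) :* (# 1 :+ o :+ b :* P :* ((# 1 :+ o) :* y)) :* (# 1 :+ o :+ (a :+ b) :* P :* ((# 1 :+ o) :* y))))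
              := k :* (z :* z :* z) :* :- (M :* ((# 1 :+ # 0 :+ o) :* (# 1 :+ # 0 :+ o) :* (# 1 :+ # 0 :+ # 0 :+ o)))
                :* (r :* ((# 1 :+ a :* y :* P) :* (# 1 :+ b :* y :* P) :* (# 1 :+ (a :+ b) :* y :* P) :* (((# 1 :+ N) :* i) :* ((# 1 :+ N) :* j))))) refl
               k₀ M₀ r zₙ (ι n) i j o a b P y ⟩
        t (suc n) * R (suc n) ∎
        where
        k = prod κ n
        M = numer (a * P) (b * P) n
        k₀ = prod (λ n → z n * z n * z n) n
        M₀ = numer 0# 0# n
        r = R n
        zₙ = z n
        i = invᵃ n
        j = invᵇ n
        o = ι 2 * ι n
        y = odd n
        factor = - (zₙ * ((1# + ι n) * zₙ * i) * ((1# + ι n) * zₙ * j)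
          * ((1# + o + a * P * ((1# + o) * y)) * (1# + o + b * P * ((1# + o) * y)) * (1# + o + (a + b) * P * ((1# + o) * y))))

      Jet-inv : ∀ {a} → (I : Inverses a) → ∀ n → n ℕ.< m → Jet ((1# + ι n) * Inverses.inv I n) (- (a * z n)) (a * z n * (a * z n))
      Jet-inv {a} I n n<m = Jet-inverse (Z-* (Z-+ Z-1 (Z-ι n)) (Z-inv n n<m)) eq (Jet-linear (Z-* Z-a (Z-z n<m)))
        where
        open Inverses I
        eq : (1# + a * z n * P) * ((1# + ι n) * inv n) ≡ 1#
        eq = trans (solve 5 (λ a z P N i →
              (# 1 :+ a :* z :* P) :* ((# 1 :+ N) :* i)
              := (# 1 :+ N :+ a :* P :* ((# 1 :+ N) :* z)) :* i) refl a (z n) P (ι n) (inv n))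
          (trans (cong (λ u → (1# + ι n + a * P * u) * inv n) (z-inverse n))
            (trans (solve 4 (λ a P N i → (# 1 :+ N :+ a :* P :* # 1) :* i := (# 1 :+ a :* P :+ N) :* i) refl a P (ι n) (inv n)) (inv-inverse n n<m)))

      Jet-R : ∀ n → n ℕ.≤ m → Jet (R n) ((a + b) * φ n) ((a + b) * (a + b) * χ n + a * b * ψ n)
      Jet-R zero _ = subst₂ (Jet 1#) (solve 2 (λ a b → # 0 := (a :+ b) :* # 0) refl a b) (solve 2 (λ a b → # 0 := (a :+ b) :* (a :+ b) :* # 0 :+ a :* b :* # 0) refl a b) Jet-1
      Jet-R (suc n) n<m = subst₂ (Jet (R (suc n)))
        (solve 5 (λ a b f y z →
              (a :+ b) :* f :+ (a :* y :+ b :* y :+ (a :+ b) :* y :+ (:- (a :* z) :+ :- (b :* z)))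
              := (a :+ b) :* (f :+ (# 2 :* y :- z))) refl a b (φ n) y zₙ)
        -- In the new quadratic term y² has the coefficient (a+b)² + ab, yz has -2(a+b)², and z² has
        -- a²+ab+b² = (a+b)² - ab.
        (solve 7 (λ a b f s c y z →
              (a :+ b) :* (a :+ b) :* c :+ a :* b :* s
                :+ (# 0 :+ # 0 :+ a :* y :* (b :* y) :+ # 0 :+ (a :* y :+ b :* y) :* ((a :+ b) :* y)
                :+ (a :* z :* (a :* z) :+ b :* z :* (b :* z) :+ :- (a :* z) :* :- (b :* z))
                :+ (a :* y :+ b :* y :+ (a :+ b) :* y) :* (:- (a :* z) :+ :- (b :* z)))
                :+ (a :+ b) :* f :* (a :* y :+ b :* y :+ (a :+ b) :* y :+ (:- (a :* z) :+ :- (b :* z)))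
              := (a :+ b) :* (a :+ b) :* (c :+ ((y :- z) :* (y :- z) :+ f :* (# 2 :* y :- z))) :+ a :* b :* (s :+ (y :* y :- z :* z))) refl
           a b (φ n) (ψ n) (χ n) y zₙ)
        (Jet-* (Jet-R n (ℕₚ.<⇒≤ n<m))
          (Jet-* (Jet-* (Jet-* (Jet-linear (Z-* Z-a₀ (Z-odd n<m))) (Jet-linear (Z-* Z-b₀ (Z-odd n<m))))
                        (Jet-linear (Z-* (Z-+ Z-a₀ Z-b₀) (Z-odd n<m))))
                 (Jet-* (Jet-inv A⁻ n n<m) (Jet-inv B⁻ n n<m))))
        where
        y = odd n
        zₙ = z n

    ¬p∣suc : ∀ {n} → suc n ℕ.< p → ¬ (p ∣ p ℕ.+ suc n)
    ¬p∣suc n<p p∣ = >⇒∤ n<p (∣m+n∣m⇒∣n p∣ ∣-refl)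

    inverses₀ : Inverses 0#
    inverses₀ = record
      { Z-a = Z-0 ; inv = z ; Z-inv = λ n n<m → Z-z n<m
      ; inv-inverse = λ n n<m → trans (cong (_* z n) (solve 2 (λ P N → # 1 :+ # 0 :* P :+ N := # 1 :+ N) refl P (ι n))) (z-inverse n) }

    inverses₁ : Inverses 1#
    inverses₁ = record
      { Z-a = Z-1 ; inv = λ n → rec (p ℕ.+ suc n) ; Z-inv = λ n n<m → Z-rec _ (¬p∣suc (suc<p n<m))
      ; inv-inverse = λ n n<m → trans (cong (_* rec (p ℕ.+ suc n)) (trans (solve 2 (λ P N → # 1 :+ # 1 :* P :+ N := P :+ (# 1 :+ N)) refl P (ι n))
          (sym (trans (ι-+ p (suc n)) (cong₂ _+_ ι-p (ι-suc n)))))) (rec-inverse _) }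

    inverses₋₁ : Inverses (- 1#)
    inverses₋₁ = record
      { Z-a = Z-neg Z-1 ; inv = λ n → - recᶜ (suc n) ; Z-inv = λ n n<m → Z-neg (Z-recᶜ (suc<p n<m))
      ; inv-inverse = λ n n<m → trans (trans (solve 3 (λ P N u → (# 1 :+ :- # 1 :* P :+ N) :* :- u := (P :- (# 1 :+ N)) :* u) refl P (ι n) (recᶜ (suc n)))
          (cong (λ u → (P - u) * recᶜ (suc n)) (sym (ι-suc n)))) (recᶜ-inverse (suc<p n<m)) }

    -- Here 1-2p+n = -(p + (p-(n+1))), whose absolute value lies strictly between p and 2p.
    inverses₋₂ : Inverses (- ι 2)
    inverses₋₂ = record
      { Z-a = Z-neg (Z-ι 2) ; inv = λ n → - rec (p ℕ.+ (p ℕ.∸ suc n)) ; Z-inv = λ n n<m → Z-neg (integral n n<m)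
      ; inv-inverse = inverse }
      where
      complement : ∀ n → n ℕ.< m → Σ ℕ λ o → p ℕ.∸ suc n ≡ suc o × suc n ℕ.+ suc o ≡ p
      complement n n<m with ℕₚ.m≤n⇒∃[o]m+o≡n (suc<p n<m)
      ... | o , eq = o , trans (cong (ℕ._∸ suc n) (sym eq′)) (ℕₚ.m+n∸m≡n (suc n) (suc o)) , eq′
        where eq′ = trans (ℕₚ.+-suc (suc n) o) eq
      integral : ∀ n → n ℕ.< m → Z (rec (p ℕ.+ (p ℕ.∸ suc n)))
      integral n n<m with complement n n<m
      ... | o , eq , sum≡p rewrite eq = Z-rec _ (¬p∣suc (subst (suc o ℕ.<_) sum≡p (ℕₚ.m<n+m (suc o) (ℕ.s≤s ℕ.z≤n))))
      inverse : ∀ n → n ℕ.< m → (1# + - ι 2 * P + ι n) * - rec (p ℕ.+ (p ℕ.∸ suc n)) ≡ 1#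
      inverse n n<m with complement n n<m
      ... | o , eq , sum≡p rewrite eq = begin
        (1# + - ι 2 * P + ι n) * - r                       ≡⟨ solve 3 (λ P N r → (# 1 :+ :- # 2 :* P :+ N) :* :- r := (P :+ (P :- (# 1 :+ N))) :* r) refl P (ι n) r ⟩
        (P + (P - (1# + ι n))) * r                         ≡⟨ cong (λ u → (P + (P - u)) * r) (ι-suc n) ⟨
        (P + (P - ι (suc n))) * r                          ≡⟨ cong (λ u → (P + (u - ι (suc n))) * r) P≡ ⟩
        (P + (ι (suc n) + ι (suc o) - ι (suc n))) * r      ≡⟨ cong (λ u → (P + u) * r) (solve 2 (λ a b → a :+ b :- a := b) refl _ _) ⟩
        (P + ι (suc o)) * r                                ≡⟨ cong (_* r) (trans (ι-+ p (suc o)) (cong (_+ ι (suc o)) ι-p)) ⟨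
        ι (p ℕ.+ suc o) * r                                ≡⟨ rec-inverse _ ⟩
        1# ∎
        where
        r = rec (p ℕ.+ suc o)
        P≡ : P ≡ ι (suc n) + ι (suc o)
        P≡ = trans (sym ι-p) (trans (cong ι (sym sum≡p)) (ι-+ (suc n) (suc o)))

    D-sum : ∀ {k f g u v} h N → (∀ n → n ℕ.≤ N → D k (f n - g n + h * (u n - v n))) →
            D k (sum N f - sum N g + h * (sum N u - sum N v))
    D-sum h zero d = d 0 ℕ.z≤n
    D-sum {f = f} {g} {u} {v} h (suc N) d = subst (D _)
      (solve 9 (λ f g u v F G U V h →
              F :- G :+ h :* (U :- V) :+ (f :- g :+ h :* (u :- v))
              := F :+ f :- (G :+ g) :+ h :* (U :+ u :- (V :+ v))) refl
        (f (suc N)) (g (suc N)) (u (suc N)) (v (suc N)) (sum N f) (sum N g) (sum N u) (sum N v) h)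
      (D-+ (D-sum h N (λ n n≤N → d n (ℕₚ.m≤n⇒m≤1+n n≤N))) (d (suc N) ℕₚ.≤-refl))

    -- The third sum

    module Sum₃ where

      private
        module X = Perturbation inverses₋₁ inverses₁
        module Y₀ = Perturbation inverses₋₁ inverses₀
        module Y₁ = Perturbation inverses₋₂ inverses₁

      summand : A → A → (ℕ → A) → ℕ → A
      summand α β κ n = T α β κ n * ℓ α β n

      F : ℕ → A
      F n = t n * (ι 3 * ι n + 1#)

      sum-X : sum m (summand (- 1# * P) (1# * P) X.κ) ≡ (- 1#) ^ m * P
      sum-X = subst₂ (λ α β → (∀ i → i ℕ.< m → δ α β i * X.κ i ≡ 1#) → sum m (summand α β X.κ) ≡ (- 1#) ^ m * P)
        (solve 1 (λ P → :- P := :- # 1 :* P) refl P) (solve 1 (λ P → P := # 1 :* P) refl P) (sum-T-symmetric m X.κ) X.δκ≡1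

      -- For (-1,0), as for (-2,1) below, α+β = -p, which is the terminating case 1+α+β = -2m.
      sum-Y₀ : sum m (summand (- 1# * P) (0# * P) Y₀.κ) ≡ 0#
      sum-Y₀ = subst (λ α → (∀ i → i ℕ.< m → δ α (0# * P) i * Y₀.κ i ≡ 1#) → sum m (summand α (0# * P) Y₀.κ) ≡ 0#)
        (solve 1 (λ M → :- (# 1 :+ # 0 :* (# 1 :+ # 2 :* M) :+ # 2 :* M) := :- # 1 :* (# 1 :+ # 2 :* M)) refl (ι m)) (sum-T-vanish (0# * P) m Y₀.κ) Y₀.δκ≡1

      sum-Y₁ : sum m (summand (- ι 2 * P) (1# * P) Y₁.κ) ≡ 0#
      sum-Y₁ = subst (λ α → (∀ i → i ℕ.< m → δ α (1# * P) i * Y₁.κ i ≡ 1#) → sum m (summand α (1# * P) Y₁.κ) ≡ 0#)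
        (solve 1 (λ M → :- (# 1 :+ # 1 :* (# 1 :+ # 2 :* M) :+ # 2 :* M) := :- # 2 :* (# 1 :+ # 2 :* M)) refl (ι m)) (sum-T-vanish (1# * P) m Y₁.κ) Y₁.δκ≡1

      -- Put l = 3n+1. Relative to `t n` and up to p³, the first difference is lψp². The other two
      -- summands share the linear factor l-p, and half their difference is -(l-p)ψp². What is left
      -- is ψp³.
      D-combination : ∀ n → n ℕ.≤ m →
        D 3 (F n - summand (- 1# * P) (1# * P) X.κ n
             + half * (summand (- ι 2 * P) (1# * P) Y₁.κ n - summand (- 1# * P) (0# * P) Y₀.κ n))
      D-combination n n≤m = subst (D 3) (sym rearrange)
        (Z-*-D (Z-t n n≤m) (D-+
          (D-+ (Z-*-D (Z-neg zl) (Jet.remainder (X.Jet-R n n≤m)))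
               (Z-*-D (Z-* Z-half (Z-- zl Z-P)) (D-- (Jet.remainder (Y₁.Jet-R n n≤m)) (Jet.remainder (Y₀.Jet-R n n≤m)))))
          (D-*-Z D-P³ (Z-ψ n n≤m))))
        where
        l = ι 3 * ι n + 1#
        zl : Z l
        zl = Z-+ (Z-* (Z-ι 3) (Z-ι n)) Z-1
        rX = X.R n
        r₀ = Y₀.R n
        r₁ = Y₁.R n
        f = φ n
        c = χ n
        s = ψ n
        eX = rX - (1# + (- 1# + 1#) * f * P + ((- 1# + 1#) * (- 1# + 1#) * c + - 1# * 1# * s) * (P * P))
        e₀ = r₀ - (1# + (- 1# + 0#) * f * P + ((- 1# + 0#) * (- 1# + 0#) * c + - 1# * 0# * s) * (P * P))
        e₁ = r₁ - (1# + (- ι 2 + 1#) * f * P + ((- ι 2 + 1#) * (- ι 2 + 1#) * c + - ι 2 * 1# * s) * (P * P))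
        rearrange : F n - summand (- 1# * P) (1# * P) X.κ n
             + half * (summand (- ι 2 * P) (1# * P) Y₁.κ n - summand (- 1# * P) (0# * P) Y₀.κ n)
             ≡ t n * (- l * eX + half * (l - P) * (e₁ - e₀) + P * (P * P) * s)
        rearrange = begin
          F n - summand (- 1# * P) (1# * P) X.κ n + half * (summand (- ι 2 * P) (1# * P) Y₁.κ n - summand (- 1# * P) (0# * P) Y₀.κ n)
            ≡⟨ cong₂ (λ u v → F n - u * ℓ (- 1# * P) (1# * P) n + half * v) (X.T≡t*R n)
                 (cong₂ (λ u v → u * ℓ (- ι 2 * P) (1# * P) n - v * ℓ (- 1# * P) (0# * P) n) (Y₁.T≡t*R n) (Y₀.T≡t*R n)) ⟩
          t n * l - t n * rX * ℓ (- 1# * P) (1# * P) n + half * (t n * r₁ * ℓ (- ι 2 * P) (1# * P) n - t n * r₀ * ℓ (- 1# * P) (0# * P) n)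
            ≡⟨ solve 10 (λ t l P h X A B f c s →
              t :* l :- t :* X :* (l :+ :- # 1 :* P :+ # 1 :* P) :+ h :* (t :* B :* (l :+ :- # 2 :* P :+ # 1 :* P) :- t :* A :* (l :+ :- # 1 :* P :+ # 0 :* P))
              := t :* (:- l :* (X :- (# 1 :+ (:- # 1 :+ # 1) :* f :* P :+ ((:- # 1 :+ # 1) :* (:- # 1 :+ # 1) :* c :+ :- # 1 :* # 1 :* s) :* (P :* P)))
                :+ h :* (l :- P) :* ((B :- (# 1 :+ (:- # 2 :+ # 1) :* f :* P :+ ((:- # 2 :+ # 1) :* (:- # 2 :+ # 1) :* c :+ :- # 2 :* # 1 :* s) :* (P :* P)))
                :- (A :- (# 1 :+ (:- # 1 :+ # 0) :* f :* P :+ ((:- # 1 :+ # 0) :* (:- # 1 :+ # 0) :* c :+ :- # 1 :* # 0 :* s) :* (P :* P))))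
                :+ P :* P :* s :* (l :- (l :- P) :* (# 2 :* h)))) refl (t n) l P half rX r₀ r₁ f c s ⟩
          t n * (- l * eX + half * (l - P) * (e₁ - e₀) + P * P * s * (l - (l - P) * (ι 2 * half)))
            ≡⟨ cong (λ u → t n * (- l * eX + half * (l - P) * (e₁ - e₀) + u))
                 (trans (cong (λ u → P * P * s * (l - (l - P) * u)) 2half) (solve 3 (λ P s l → P :* P :* s :* (l :- (l :- P) :* # 1) := P :* (P :* P) :* s) refl P s l)) ⟩
          t n * (- l * eX + half * (l - P) * (e₁ - e₀) + P * (P * P) * s) ∎

      congruence-short : D 3 (sum m F - (- 1#) ^ m * P)
      congruence-short = subst (D 3)
        (trans (cong₂ (λ u v → sum m F - u + half * v) sum-X (cong₂ _-_ sum-Y₁ sum-Y₀))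
               (solve 3 (λ s x h → s :- x :+ h :* (# 0 :- # 0) := s :- x) refl (sum m F) _ half))
        (D-sum half m D-combination)

      -- Each of the three factors 1+2n is 2(½+n), hence (-8)ⁿ. In this form the summand is that of
      -- the theorem, and its divisibility by p³ for n > m is visible.
      t≡q³ : ∀ n → t n ≡ q half n ^ 3 * (- ι 8) ^ n
      t≡q³ zero = solve 0 (# 1 :* # 1 := # 1 :* # 1 :* # 1 :* # 1 :* # 1) refl
      t≡q³ (suc n) = begin
        k * (zₙ * zₙ * zₙ) * - (M * ((1# + 0# + ι 2 * N) * (1# + 0# + ι 2 * N) * (1# + 0# + 0# + ι 2 * N)))
          ≡⟨ solve 4 (λ k z M N →
              k :* (z :* z :* z) :* :- (M :* ((# 1 :+ # 0 :+ # 2 :* N) :* (# 1 :+ # 0 :+ # 2 :* N) :* (# 1 :+ # 0 :+ # 0 :+ # 2 :* N)))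
              := k :* M :* (z :* z :* z) :* :- ((# 1 :+ # 2 :* N) :* (# 1 :+ # 2 :* N) :* (# 1 :+ # 2 :* N))) refl k zₙ M N ⟩
        t n * (zₙ * zₙ * zₙ) * - ((1# + ι 2 * N) * (1# + ι 2 * N) * (1# + ι 2 * N))
          ≡⟨ cong₂ (λ u v → u * (zₙ * zₙ * zₙ) * - ((v + ι 2 * N) * (v + ι 2 * N) * (v + ι 2 * N))) (t≡q³ n) (sym 2half) ⟩
        q half n ^ 3 * (- ι 8) ^ n * (zₙ * zₙ * zₙ) * - ((ι 2 * half + ι 2 * N) * (ι 2 * half + ι 2 * N) * (ι 2 * half + ι 2 * N))
          ≡⟨ solve 5 (λ q e z h N →
              # 1 :* q :* q :* q :* e :* (z :* z :* z) :* :- ((# 2 :* h :+ # 2 :* N) :* (# 2 :* h :+ # 2 :* N) :* (# 2 :* h :+ # 2 :* N))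
              := # 1 :* (q :* (h :+ N) :* z) :* (q :* (h :+ N) :* z) :* (q :* (h :+ N) :* z) :* (e :* :- # 8)) refl (q half n) ((- ι 8) ^ n) zₙ half N ⟩
        q half (suc n) ^ 3 * (- ι 8) ^ suc n ∎
        where
        k = prod (λ n → z n * z n * z n) n
        M = numer 0# 0# n
        N = ι n
        zₙ = z n

      D-tail : ∀ n → m ℕ.< n → n ℕ.≤ m ℕ.+ m → D 3 (F n)
      D-tail n m<n n≤2m = D-*-Z
        (subst (D 3) (sym (t≡q³ n)) (D-*-Z (D-^ 3 (D-q Z-half m<n (ℕ.s≤s n≤2m) D-half+m)) (Z-^ n (Z-neg (Z-ι 8)))))
        (Z-+ (Z-* (Z-ι 3) (Z-ι n)) Z-1)

      congruence : D 3 (sum (m ℕ.+ m) F - (- 1#) ^ m * P)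
      congruence = D-trans (D-sum-tail m (m ℕ.+ m) D-tail (ℕₚ.m≤m+n m m)) congruence-short


-- Rational numbers and translation of the three summands

module ℚ-Ring = Ring ℚₚ.+-*-isCommutativeRing
open ℚ-Ring using (ι; ι-suc; ι-*; solve; _:=_; _:+_; _:*_; _:-_; :-_; #; _^_)

ℕ→ℚ≡mkℚ : ∀ n → ℕ→ℚ n ≡ mkℚ (pos n) 0 (Coprimality.sym (1-coprimeTo n))
ℕ→ℚ≡mkℚ n = ℚₚ.normalize-coprime (Coprimality.sym (1-coprimeTo n))

1//≡mkℚ : ∀ n → pos 1 // suc n ≡ mkℚ (pos 1) n (1-coprimeTo (suc n))
1//≡mkℚ n = ℚₚ.normalize-coprime (1-coprimeTo (suc n))

ℕ→ℚ-suc : ∀ n → ℕ→ℚ (suc n) ≡ 1ℚ ℚ.+ ℕ→ℚ n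
ℕ→ℚ-suc n = sym (begin
  1ℚ ℚ.+ ℕ→ℚ n              ≡⟨ cong (1ℚ ℚ.+_) (ℕ→ℚ≡mkℚ n) ⟩
  (pos 1 ℤ.* pos 1 ℤ.+ pos n ℤ.* pos 1) // 1
                            ≡⟨ cong (λ i → (pos 1 ℤ.+ i) // 1) (ℤₚ.*-identityʳ (pos n)) ⟩
  ℕ→ℚ (suc n) ∎)

ℕ→ℚ≡ι : ∀ n → ℕ→ℚ n ≡ ι n
ℕ→ℚ≡ι zero = refl
ℕ→ℚ≡ι (suc n) = trans (ℕ→ℚ-suc n) (trans (cong (1ℚ ℚ.+_) (ℕ→ℚ≡ι n)) (sym (ι-suc n)))

1//-inverse : ∀ n .{{_ : ℕ.NonZero n}} → ι n ℚ.* (pos 1 // n) ≡ 1ℚ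
1//-inverse (suc n) = begin
  ι (suc n) ℚ.* (pos 1 // suc n)    ≡⟨ cong₂ ℚ._*_ (trans (sym (ℕ→ℚ≡ι (suc n))) (ℕ→ℚ≡mkℚ (suc n))) (1//≡mkℚ n) ⟩
  x ℚ.* (ℚ.1/ x)                    ≡⟨ ℚₚ.*-inverseʳ x ⟩
  1ℚ ∎
  where x = mkℚ (pos (suc n)) 0 (Coprimality.sym (1-coprimeTo (suc n)))

-- The value at 0 is irrelevant.
rec : ℕ → ℚ
rec zero = 0ℚ
rec (suc n) = pos 1 // suc n

open Hypergeometric ℚₚ.+-*-isCommutativeRing rec (λ n → 1//-inverse (suc n))

^≡^ℚ : ∀ x n → x ^ n ≡ x ^ℚ n
^≡^ℚ x zero = refl
^≡^ℚ x (suc n) = cong (ℚ._* x) (^≡^ℚ x n)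

sum≡sumTo : ∀ {f g} → (∀ n → f n ≡ g n) → ∀ N → ℚ-Ring.sum N f ≡ sumTo N g
sum≡sumTo f≡g zero = f≡g 0
sum≡sumTo f≡g (suc N) = cong₂ ℚ._+_ (sum≡sumTo f≡g N) (f≡g (suc N))

-- Uniqueness of inverses avoids a comparison of reduced fractions.
inv!-suc : ∀ n → inv! (suc n) ≡ inv! n ℚ.* rec (suc n)
inv!-suc n = ℚ-Ring.inverse-unique {ι (suc n !)} (1//-inverse (suc n !) {{suc n !≢0}}) (begin
  ι (suc n !) ℚ.* (inv! n ℚ.* rec (suc n))
    ≡⟨ cong (ℚ._* (inv! n ℚ.* rec (suc n))) (ι-* (suc n) (n !)) ⟩
  ι (suc n) ℚ.* ι (n !) ℚ.* (inv! n ℚ.* rec (suc n))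
    ≡⟨ solve 4 (λ a b c d → a :* b :* (c :* d) := b :* c :* (a :* d)) refl (ι (suc n)) (ι (n !)) (inv! n) (rec (suc n)) ⟩
  ι (n !) ℚ.* inv! n ℚ.* (ι (suc n) ℚ.* rec (suc n))
    ≡⟨ cong₂ ℚ._*_ (1//-inverse (n !) {{n !≢0}}) (1//-inverse (suc n)) ⟩
  1ℚ ∎)

q½≡ : ∀ n → q ½ n ≡ poch ½ n ℚ.* inv! n
q½≡ zero = refl
q½≡ (suc n) = begin
  q ½ n ℚ.* (½ ℚ.+ ι n) ℚ.* rec (suc n)
    ≡⟨ cong₂ (λ u v → u ℚ.* (½ ℚ.+ v) ℚ.* rec (suc n)) (q½≡ n) (sym (ℕ→ℚ≡ι n)) ⟩
  poch ½ n ℚ.* inv! n ℚ.* (½ ℚ.+ ℕ→ℚ n) ℚ.* rec (suc n)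
    ≡⟨ solve 4 (λ a i x r → a :* i :* x :* r := a :* x :* (i :* r)) refl (poch ½ n) (inv! n) (½ ℚ.+ ℕ→ℚ n) (rec (suc n)) ⟩
  poch ½ (suc n) ℚ.* (inv! n ℚ.* rec (suc n))
    ≡⟨ cong (poch ½ (suc n) ℚ.*_) (inv!-suc n) ⟨
  poch ½ (suc n) ℚ.* inv! (suc n) ∎

ℕ→ℚ-* : ∀ m n → ℕ→ℚ (m ℕ.* n) ≡ ι m ℚ.* ι n
ℕ→ℚ-* m n = trans (ℕ→ℚ≡ι (m ℕ.* n)) (ι-* m n)

2^-* : ∀ k n → ℕ→ℚ 2 ^ℚ (k ℕ.* n) ≡ (ι 2 ^ k) ^ n
2^-* k n = trans (sym (^≡^ℚ (ℕ→ℚ 2) (k ℕ.* n))) (ℚ-Ring.^-* (ℕ→ℚ 2) k n)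

term1≡ : ∀ n → weight 1ℚ n ℚ.* q ½ n ^ 2 ℚ.* (ι 3 ℚ.* ι n ℚ.+ ι 2 ℚ.* ½) ≡ term1 n
term1≡ n = begin
  -- The closed term `ι 2 ℚ.* ½` computes to `1ℚ`; in `term2≡` the multiples of ½ evaluate in the
  -- same way.
  weight 1ℚ n ℚ.* q ½ n ^ 2 ℚ.* (ι 3 ℚ.* ι n ℚ.+ 1ℚ)
    ≡⟨ cong₂ (λ w x → w ℚ.* x ^ 2 ℚ.* (ι 3 ℚ.* ι n ℚ.+ 1ℚ))
         (trans (weight≡4ⁿq n) (cong (ι 4 ^ n ℚ.*_) (q½≡ n))) (q½≡ n) ⟩
  ι 4 ^ n ℚ.* (x ℚ.* i) ℚ.* (x ℚ.* i) ^ 2 ℚ.* (ι 3 ℚ.* ι n ℚ.+ 1ℚ)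
    ≡⟨ solve 4 (λ f x i l →
              f :* (x :* i) :* (# 1 :* (x :* i) :* (x :* i)) :* l
              := # 1 :* x :* x :* x :* (# 1 :* i :* i :* i) :* l :* f) refl
         (ι 4 ^ n) x i (ι 3 ℚ.* ι n ℚ.+ 1ℚ) ⟩
  x ^ℚ 3 ℚ.* i ^ℚ 3 ℚ.* (ι 3 ℚ.* ι n ℚ.+ 1ℚ) ℚ.* ι 4 ^ n
    ≡⟨ cong₂ (λ l f → x ^ℚ 3 ℚ.* i ^ℚ 3 ℚ.* (l ℚ.+ 1ℚ) ℚ.* f) (sym (ℕ→ℚ-* 3 n)) (sym (2^-* 2 n)) ⟩
  term1 n ∎
  where
  x = poch ½ n
  i = inv! n

term2≡ : ∀ n → weight (ℚ.- 1ℚ) n ℚ.* q ½ n ^ 4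
                 ℚ.* (ι 10 ℚ.* (ι n ℚ.* ι n) ℚ.+ ι 12 ℚ.* ½ ℚ.* ι n ℚ.+ ι 4 ℚ.* (½ ℚ.* ½)) ≡ term2 n
term2≡ n = begin
  weight (ℚ.- 1ℚ) n ℚ.* q ½ n ^ 4 ℚ.* l
    ≡⟨ cong₂ (λ w x → w ℚ.* x ^ 4 ℚ.* l)
         (trans (weight-sign (ℚ.- 1ℚ) n) (cong (s ℚ.*_) (trans (weight≡4ⁿq n) (cong (ι 4 ^ n ℚ.*_) (q½≡ n))))) (q½≡ n) ⟩
  s ℚ.* (ι 4 ^ n ℚ.* (x ℚ.* i)) ℚ.* (x ℚ.* i) ^ 4 ℚ.* l
    ≡⟨ solve 5 (λ s f x i l →
              s :* (f :* (x :* i)) :* (# 1 :* (x :* i) :* (x :* i) :* (x :* i) :* (x :* i)) :* l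
              := # 1 :* x :* x :* x :* x :* x :* (# 1 :* i :* i :* i :* i :* i) :* l :* s :* f) refl s (ι 4 ^ n) x i l ⟩
  x ^ℚ 5 ℚ.* i ^ℚ 5 ℚ.* (ι 10 ℚ.* (ι n ℚ.* ι n) ℚ.+ ι 6 ℚ.* ι n ℚ.+ 1ℚ) ℚ.* s ℚ.* ι 4 ^ n
    ≡⟨ cong₂ (λ l s → x ^ℚ 5 ℚ.* i ^ℚ 5 ℚ.* (l ℚ.+ 1ℚ) ℚ.* s ℚ.* ι 4 ^ n)
         (sym (cong₂ ℚ._+_ (trans (ℕ→ℚ-* 10 (n ℕ.* n)) (cong (ι 10 ℚ.*_) (ι-* n n))) (ℕ→ℚ-* 6 n)))
         (^≡^ℚ (ℚ.- 1ℚ) n) ⟩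
  x ^ℚ 5 ℚ.* i ^ℚ 5 ℚ.* (ℕ→ℚ (10 ℕ.* (n ℕ.* n)) ℚ.+ ℕ→ℚ (6 ℕ.* n) ℚ.+ 1ℚ) ℚ.* (ℚ.- 1ℚ) ^ℚ n ℚ.* ι 4 ^ n
    ≡⟨ cong (x ^ℚ 5 ℚ.* i ^ℚ 5 ℚ.* (ℕ→ℚ (10 ℕ.* (n ℕ.* n)) ℚ.+ ℕ→ℚ (6 ℕ.* n) ℚ.+ 1ℚ) ℚ.* (ℚ.- 1ℚ) ^ℚ n ℚ.*_) (sym (2^-* 2 n)) ⟩
  term2 n ∎
  where
  x = poch ½ n
  i = inv! n
  s = (ℚ.- 1ℚ) ^ n
  l = ι 10 ℚ.* (ι n ℚ.* ι n) ℚ.+ ι 6 ℚ.* ι n ℚ.+ 1ℚ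

term3≡ : ∀ n → q ½ n ^ 3 ℚ.* (ℚ.- ι 8) ^ n ℚ.* (ι 3 ℚ.* ι n ℚ.+ 1ℚ) ≡ term3 n
term3≡ n = begin
  q ½ n ^ 3 ℚ.* (ℚ.- ι 8) ^ n ℚ.* l
    ≡⟨ cong₂ (λ x e → x ^ 3 ℚ.* e ℚ.* l) (q½≡ n) (ℚ-Ring.^-distrib-* (ℚ.- 1ℚ) (ι 8) n) ⟩
  (x ℚ.* i) ^ 3 ℚ.* (s ℚ.* ι 8 ^ n) ℚ.* l
    ≡⟨ solve 5 (λ x i s f l →
              # 1 :* (x :* i) :* (x :* i) :* (x :* i) :* (s :* f) :* l
              := # 1 :* x :* x :* x :* (# 1 :* i :* i :* i) :* l :* s :* f) refl x i s (ι 8 ^ n) l ⟩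
  x ^ℚ 3 ℚ.* i ^ℚ 3 ℚ.* l ℚ.* s ℚ.* ι 8 ^ n
    ≡⟨ cong₂ (λ l s → x ^ℚ 3 ℚ.* i ^ℚ 3 ℚ.* (l ℚ.+ 1ℚ) ℚ.* s ℚ.* ι 8 ^ n) (sym (ℕ→ℚ-* 3 n)) (^≡^ℚ (ℚ.- 1ℚ) n) ⟩
  x ^ℚ 3 ℚ.* i ^ℚ 3 ℚ.* (ℕ→ℚ (3 ℕ.* n) ℚ.+ 1ℚ) ℚ.* (ℚ.- 1ℚ) ^ℚ n ℚ.* ι 8 ^ n
    ≡⟨ cong (x ^ℚ 3 ℚ.* i ^ℚ 3 ℚ.* (ℕ→ℚ (3 ℕ.* n) ℚ.+ 1ℚ) ℚ.* (ℚ.- 1ℚ) ^ℚ n ℚ.*_) (sym (2^-* 3 n)) ⟩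
  term3 n ∎
  where
  x = poch ½ n
  i = inv! n
  s = (ℚ.- 1ℚ) ^ n
  l = ι 3 ℚ.* ι n ℚ.+ 1ℚ

-- Odd primes, p-integral rationals and the final congruences

even⊎odd : ∀ n → ∃ λ m → n ≡ m ℕ.+ m ⊎ n ≡ suc (m ℕ.+ m)
even⊎odd zero = 0 , inj₁ refl
even⊎odd (suc n) with even⊎odd n
... | m , inj₁ refl = m , inj₂ refl
... | m , inj₂ refl = suc m , inj₁ (cong suc (sym (ℕₚ.+-suc m m)))

prime-odd : ∀ {p} → Prime p → 2 ℕ.< p → ∃ λ m → p ≡ suc (m ℕ.+ m)
prime-odd {p} p-prime 2<p with even⊎odd p
... | m , inj₂ p≡ = m , p≡
... | m , inj₁ p≡ with prime⇒irreducible p-prime (divides m (trans p≡ (trans (cong (m ℕ.+_) (sym (ℕₚ.+-identityʳ m))) (ℕₚ.*-comm 2 m))))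
...   | inj₁ ()
...   | inj₂ 2≡p = ⊥-elim (ℕₚ.<⇒≢ 2<p 2≡p)

module Integrality {p : ℕ} (p-prime : Prime p) where

  Z : ℚ → Set
  Z x = ¬ (p ∣ ℚ.↧ₙ x)

  -- The number c is the common factor cancelled when a sum or product of reduced fractions is
  -- reduced again. Euclid's lemma then shows that no new p enters a denominator.
  denominator-∣ : ∀ x y z {c} → ℚ.↧ z ℤ.* c ≡ ℚ.↧ x ℤ.* ℚ.↧ y → ℚ.↧ₙ z ∣ ℚ.↧ₙ x ℕ.* ℚ.↧ₙ y
  denominator-∣ x y z {c} eq = divides ℤ.∣ c ∣ (begin
    ℚ.↧ₙ x ℕ.* ℚ.↧ₙ y          ≡⟨ ℤₚ.abs-* (ℚ.↧ x) (ℚ.↧ y) ⟨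
    ℤ.∣ ℚ.↧ x ℤ.* ℚ.↧ y ∣       ≡⟨ cong ℤ.∣_∣ eq ⟨
    ℤ.∣ ℚ.↧ z ℤ.* c ∣           ≡⟨ ℤₚ.abs-* (ℚ.↧ z) c ⟩
    ℚ.↧ₙ z ℕ.* ℤ.∣ c ∣          ≡⟨ ℕₚ.*-comm (ℚ.↧ₙ z) ℤ.∣ c ∣ ⟩
    ℤ.∣ c ∣ ℕ.* ℚ.↧ₙ z ∎)

  Z-∣ : ∀ {x y z} → ℚ.↧ₙ z ∣ ℚ.↧ₙ x ℕ.* ℚ.↧ₙ y → Z x → Z y → Z z
  Z-∣ {x} {y} z∣xy zx zy p∣z with euclidsLemma (ℚ.↧ₙ x) (ℚ.↧ₙ y) p-prime (∣-trans p∣z z∣xy)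
  ... | inj₁ p∣x = zx p∣x
  ... | inj₂ p∣y = zy p∣y

  Z-+ : ∀ {x y} → Z x → Z y → Z (x ℚ.+ y)
  Z-+ {x} {y} = Z-∣ {x} {y} {x ℚ.+ y} (denominator-∣ x y (x ℚ.+ y) (ℚₚ.↧-+ x y))

  Z-* : ∀ {x y} → Z x → Z y → Z (x ℚ.* y)
  Z-* {x} {y} = Z-∣ {x} {y} {x ℚ.* y} (denominator-∣ x y (x ℚ.* y) (ℚₚ.↧-* x y))

  Z-neg : ∀ {x} → Z x → Z (ℚ.- x)
  Z-neg {x} zx p∣ = zx (subst (p ∣_) (ℤₚ.+-injective (ℚₚ.↧-neg x)) p∣)

  Z-1 : Z 1ℚ
  Z-1 p∣1 with ∣1⇒≡1 p∣1
  ... | refl = ¬prime[1] p-prime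

  Z-rec : ∀ n → ¬ (p ∣ n) → Z (rec n)
  Z-rec zero ¬p∣0 = ⊥-elim (¬p∣0 (p ∣0))
  Z-rec (suc n) ¬p∣n p∣ = ¬p∣n (subst (p ∣_) (cong ℚ.↧ₙ_ (1//≡mkℚ n)) p∣)

module Congruences (m : ℕ) (p-prime : Prime (suc (m ℕ.+ m))) (2<p : 2 ℕ.< suc (m ℕ.+ m)) where

  0<m : 0 ℕ.< m
  0<m = ℕₚ.n≢0⇒n>0 λ { refl → ℕₚ.<⇒≱ 2<p (ℕ.s≤s ℕ.z≤n) }

  open Integrality p-prime
  open Local m 0<m Z Z-1 (λ {x} {y} → Z-+ {x} {y}) (λ {x} {y} → Z-* {x} {y}) (λ {x} → Z-neg {x}) Z-rec
    using (D; multiple; P; p; ι-p; module Sum₁; module Sum₂; module Sum₃)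

  P≡ : P ≡ ℕ→ℚ p
  P≡ = sym (trans (ℕ→ℚ≡ι p) ι-p)

  D⇒CongPow : ∀ {k a b a' b'} → a ≡ a' → b ≡ b' → D k (a ℚ.- b) → CongPow p k a' b'
  D⇒CongPow {k} refl refl (multiple y zy eq) =
    y , trans eq (cong (ℚ._* y) (trans (^≡^ℚ P k) (cong (_^ℚ k) P≡))) , zy

  ⌊p/2⌋ : ⌊ m ℕ.+ m /2⌋ ≡ m
  ⌊p/2⌋ = sym (ℕₚ.n≡⌊n+n/2⌋ m)

  congruence₁ : CongPow p 3 (sumTo ⌊ m ℕ.+ m /2⌋ term1) (ℕ→ℚ p)
  congruence₁ = D⇒CongPow (trans (sum≡sumTo term1≡ m) (cong (λ N → sumTo N term1) (sym ⌊p/2⌋))) P≡ Sum₁.congruence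

  congruence₂ : 3 ℕ.< p → CongPow p 5 (sumTo ⌊ m ℕ.+ m /2⌋ term2) (ℕ→ℚ p ^ℚ 2)
  congruence₂ 3<p = D⇒CongPow (trans (sum≡sumTo term2≡ m) (cong (λ N → sumTo N term2) (sym ⌊p/2⌋)))
    (trans (solve 1 (λ x → x :* x := # 1 :* x :* x) refl P) (cong (_^ℚ 2) P≡)) (Sum₂.congruence 3<p)

  congruence₃ : CongPow p 3 (sumTo (m ℕ.+ m) term3) ((ℚ.- 1ℚ) ^ℚ ⌊ m ℕ.+ m /2⌋ ℚ.* ℕ→ℚ p)
  congruence₃ = D⇒CongPow
    (sum≡sumTo (λ n → trans (cong (ℚ._* (ι 3 ℚ.* ι n ℚ.+ 1ℚ)) (Sum₃.t≡q³ n)) (term3≡ n)) (m ℕ.+ m))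
    (cong₂ ℚ._*_ (trans (^≡^ℚ (ℚ.- 1ℚ) m) (cong ((ℚ.- 1ℚ) ^ℚ_) (sym ⌊p/2⌋))) P≡) Sum₃.congruence

open import Data.Rational using (-_; _*_)

mainTheorem1 : (p : ℕ) → Prime p →
    (2 < p → CongPow p 3 (sumTo ⌊ p ∸ 1 /2⌋ term1) (ℕ→ℚ p))
    × (3 < p → CongPow p 5 (sumTo ⌊ p ∸ 1 /2⌋ term2) (ℕ→ℚ p ^ℚ 2))
    × (2 < p → CongPow p 3 (sumTo (p ∸ 1) term3) (((- 1ℚ) ^ℚ ⌊ p ∸ 1 /2⌋) * ℕ→ℚ p))
mainTheorem1 p p-prime = first , second , third
  where
  first : 2 < p → CongPow p 3 (sumTo ⌊ p ∸ 1 /2⌋ term1) (ℕ→ℚ p)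
  first 2<p with prime-odd p-prime 2<p
  ... | m , refl = Congruences.congruence₁ m p-prime 2<p
  second : 3 < p → CongPow p 5 (sumTo ⌊ p ∸ 1 /2⌋ term2) (ℕ→ℚ p ^ℚ 2)
  second 3<p with prime-odd p-prime (ℕₚ.<⇒≤ 3<p)
  ... | m , refl = Congruences.congruence₂ m p-prime (ℕₚ.<⇒≤ 3<p) 3<p
  third : 2 < p → CongPow p 3 (sumTo (p ∸ 1) term3) (((- 1ℚ) ^ℚ ⌊ p ∸ 1 /2⌋) * ℕ→ℚ p)
  third 2<p with prime-odd p-prime 2<p
  ... | m , refl = Congruences.congruence₃ m p-prime 2<p
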